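{- Let $q$ be a prime power, let $A, B, C, D\subseteq M_2(\mathbb{F}_q)$ and let $\mathcal{J}$ denote the number of solutions to \[ a+b = c d, \quad (a, b, c, d)\in A\times B\times C\times D. \] Then \[ \mathcal{J} \ll \frac{|A||B|^{1/2}|C||D|}{q^2} + q^{13/4} (|A||B||C||D|)^{1/2}. \]
   Context: $M_2(\mathbb{F}_q)$ is the ring of $2\times 2$ matrices over the finite field $\mathbb{F}_q$; $cd$ is the matrix product. The notation $X\ll Y$ means $X\le cY$ for an absolute constant $c>0$. -}

module Defs where

open import Data.Nat using (ℕ; suc; _^_)
open import Data.Nat.Primality using (Prime)
open import Data.Fin using (Fin)
import Data.Fin.Properties as FinP
open import Data.Product using (Σ; ∃; _×_; _,_)
open import Data.List using (List; length; map; filter)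
open import Data.Nat.ListAction using (sum)
open import Function.Bundles using (_↔_; Inverse)
open import Relation.Nullary using (¬_; Dec; yes; no)
open import Relation.Binary.PropositionalEquality
open import Algebra.Structures using (IsCommutativeRing)

IsPrimePower : ℕ → Set
IsPrimePower q = Σ ℕ λ p → Σ ℕ λ k → Prime p × (q ≡ p ^ suc k)

record FiniteField (q : ℕ) : Set₁ where
  field
    Carrier : Set
    _+_ _*_ : Carrier → Carrier → Carrier
    -_      : Carrier → Carrier
    0# 1#   : Carrier
    isCommutativeRing : IsCommutativeRing _≡_ _+_ _*_ -_ 0# 1#
    0≢1     : ¬ (0# ≡ 1#)
    inverse : ∀ x → ¬ (x ≡ 0#) → Σ Carrier λ y → x * y ≡ 1#
    enum    : Fin q ↔ Carrier

  _≟_ : (x y : Carrier) → Dec (x ≡ y)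
  x ≟ y with FinP._≟_ (Inverse.from enum x) (Inverse.from enum y)
  ... | yes e = yes (trans (sym (Inverse.strictlyInverseˡ enum x))
                     (trans (cong (Inverse.to enum) e) (Inverse.strictlyInverseˡ enum y)))
  ... | no ne = no (λ e → ne (cong (Inverse.from enum) e))

module M2 {q : ℕ} (F : FiniteField q) where
  open FiniteField F

  record Mat : Set where
    constructor mat
    field
      m11 m12 m21 m22 : Carrier

  _+M_ : Mat → Mat → Mat
  mat a b c d +M mat a' b' c' d' = mat (a + a') (b + b') (c + c') (d + d')

  _*M_ : Mat → Mat → Mat
  mat a b c d *M mat a' b' c' d' =
    mat ((a * a') + (b * c')) ((a * b') + (b * d'))
        ((c * a') + (d * c')) ((c * b') + (d * d'))

  _≟M_ : (x y : Mat) → Dec (x ≡ y)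
  mat a b c d ≟M mat a' b' c' d' with a ≟ a' | b ≟ b' | c ≟ c' | d ≟ d'
  ... | yes refl | yes refl | yes refl | yes refl = yes refl
  ... | no n | _ | _ | _ = no (λ { refl → n refl })
  ... | yes _ | no n | _ | _ = no (λ { refl → n refl })
  ... | yes _ | yes _ | no n | _ = no (λ { refl → n refl })
  ... | yes _ | yes _ | yes _ | no n = no (λ { refl → n refl })

  -- number of (a,b,c,d) ∈ A×B×C×D with a + b = c d
  -- (subsets are given as duplicate-free lists)
  energy : List Mat → List Mat → List Mat → List Mat → ℕ
  energy A B C D =
    sum (map (λ a → sum (map (λ b → sum (map (λ c →
      length (filter (λ d → (a +M b) ≟M (c *M d)) D)) C)) B)) A)

{-# OPTIONS --safe #-}

-- Write X = B × D, Y = A × C, and let N(a,c) count the (b,d) ∈ X with a + b = c d. Over all (a,c) the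
-- mean of N is |X|/q⁴, so by Cauchy–Schwarz it suffices to bound the variance: Σ N² ≤ |X|² + 3 q⁶ |X|
-- gives |J − |X||Y|/q⁴|² ≤ 3 q⁶ |X||Y|, and |B| ≤ q⁴ turns this into the claim.
--
-- Σ N² counts, over pairs (b,d), (b′,d′) ∈ X, the solutions c of c (d − d′) = b − b′. There is at most
-- one if d − d′ is invertible. If d − d′ has rank one there are at most q², and none unless b − b′ also
-- vanishes on its kernel w. So the pairs with b w = b′ w and d w = d′ w, for w on the projective line,
-- have to be counted. For different w the fibres of (b,d) ↦ (b w, d w) meet in at most one point, and
-- the variance argument applied to these fibres shows that there are at most
-- (q + 1)|X|²/q⁴ + q⁴|X| such pairs. The main term here is cancelled by the pairs with singular
-- d − d′, which by Cauchy–Schwarz number at least about (q + 1)|X|²/q² and were counted as if invertible.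
module Submission where

open import Defs
open import Level using (0ℓ)
open import Algebra.Bundles using (CommutativeRing)
import Algebra.Properties.Group as GroupProperties
import Algebra.Solver.Ring.NaturalCoefficients.Default as SemiringSolver
open import Data.Fin.Base using (Fin)
import Data.Integer.Properties as ℤ
open import Data.Integer.Tactic.RingSolver using (solve-∀)
open import Data.List.Base using
  (List; []; _∷_; length; map; filter; _++_; allFin; cartesianProduct; cartesianProductWith)
open import Data.List.Membership.Propositional using (_∈_; find; lose)
open import Data.List.Membership.Propositional.Properties using (∈-map⁺; ∈-allFin; ∈-cartesianProductWith⁺)
open import Data.List.Properties using (length-map; length-tabulate)
open import Data.List.Relation.Unary.All as All using (All; []; _∷_)
import Data.List.Relation.Unary.All.Properties as All
open import Data.List.Relation.Unary.AllPairs using ([]; _∷_)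
open import Data.List.Relation.Unary.Any using (here; there; any?)
open import Data.List.Relation.Unary.Unique.Propositional using (Unique)
import Data.List.Relation.Unary.Unique.Propositional.Properties as Unique
open import Data.Maybe.Base using (Maybe; just; nothing)
import Data.Maybe.Properties as Maybe
open import Data.Nat.Base as ℕ using (ℕ; suc; _^_)
open import Data.Nat.ListAction using (sum)
import Data.Nat.Properties as ℕ
open import Data.Nat.Solver using (module +-*-Solver)
open import Data.Product using (Σ; ∃; _×_; _,_; proj₁; proj₂)
open import Data.Product.Properties using (≡-dec)
open import Data.Sum using (_⊎_; inj₁; inj₂; [_,_]′)
open import Function.Base using (id)
open import Function.Bundles using (Inverse)
open import Relation.Binary.Definitions using (DecidableEquality)
open import Relation.Binary.PropositionalEquality hiding (J)
open import Relation.Nullary using (¬_; Dec; yes; no; contradiction)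
open import Relation.Nullary.Decidable using (_×-dec_)

-- Finite sums over lists, counting by indicators, and variance.

module FiniteSums where
  open import Data.Integer.Base
    using (ℤ; +_; -[1+_]; _+_; _*_; -_; _-_; _≤_; 0ℤ; 1ℤ; +≤+; nonNegative; Positive)

  private variable
    A B V W : Set
    P Q : Set

  0≤+ : ∀ {n} → 0ℤ ≤ + n
  0≤+ = +≤+ ℕ.z≤n

  -- Serves to derive linear consequences of inequalities: the combined inequality is the premise,
  -- and the ring solver checks that the two differences agree.
  ≤-from-difference : ∀ {i j k l} → i ≤ j → j - i ≡ l - k → k ≤ l
  ≤-from-difference i≤j eq = ℤ.0≤i-j⇒j≤i (subst (0ℤ ≤_) eq (ℤ.i≤j⇒0≤j-i i≤j))

  0≤-+ : ∀ {i j} → 0ℤ ≤ i → 0ℤ ≤ j → 0ℤ ≤ i + j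
  0≤-+ = ℤ.+-mono-≤

  *-monoˡ-≤ : ∀ i {j k} → 0ℤ ≤ i → j ≤ k → i * j ≤ i * k
  *-monoˡ-≤ i 0≤i = ℤ.*-monoˡ-≤-nonNeg i {{nonNegative 0≤i}}

  *-monoʳ-≤ : ∀ i {j k} → 0ℤ ≤ i → j ≤ k → j * i ≤ k * i
  *-monoʳ-≤ i 0≤i = ℤ.*-monoʳ-≤-nonNeg i {{nonNegative 0≤i}}

  0≤-* : ∀ {i j} → 0ℤ ≤ i → 0ℤ ≤ j → 0ℤ ≤ i * j
  0≤-* {i} 0≤i 0≤j = ℤ.≤-trans (ℤ.≤-reflexive (sym (ℤ.*-zeroʳ i))) (*-monoˡ-≤ i 0≤i 0≤j)

  0≤i*i : ∀ i → 0ℤ ≤ i * i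
  0≤i*i (+ n)    = 0≤-* {+ n} 0≤+ 0≤+
  0≤i*i -[1+ n ] = 0≤+

  *-pos : ∀ i j .{{_ : Positive i}} .{{_ : Positive j}} → Positive (i * j)
  *-pos (+ suc _) (+ suc _) = _

  ∑ : List A → (A → ℤ) → ℤ
  ∑ []       f = 0ℤ
  ∑ (x ∷ xs) f = f x + ∑ xs f

  infix 3 ∑
  syntax ∑ xs (λ x → e) = ∑[ x ∈ xs ] e

  ∣_∣ : List A → ℤ
  ∣ xs ∣ = + length xs

  +-congʳ : ∀ i {j k} → j ≡ k → i + j ≡ i + k
  +-congʳ i refl = refl

  private
    +-interchange : ∀ i j k l → (i + j) + (k + l) ≡ (i + k) + (j + l)
    +-interchange = solve-∀

  ∑-cong : ∀ (xs : List A) {f g} → (∀ x → f x ≡ g x) → ∑ xs f ≡ ∑ xs g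
  ∑-cong []       eq = refl
  ∑-cong (x ∷ xs) eq = cong₂ _+_ (eq x) (∑-cong xs eq)

  ∑-mono : ∀ (xs : List A) {f g} → (∀ x → f x ≤ g x) → ∑ xs f ≤ ∑ xs g
  ∑-mono []       le = ℤ.≤-refl
  ∑-mono (x ∷ xs) le = ℤ.+-mono-≤ (le x) (∑-mono xs le)

  ∑-nonneg : ∀ (xs : List A) {f} → (∀ x → 0ℤ ≤ f x) → 0ℤ ≤ ∑ xs f
  ∑-nonneg []       le = ℤ.≤-refl
  ∑-nonneg (x ∷ xs) le = 0≤-+ (le x) (∑-nonneg xs le)

  ∑-+ : ∀ (xs : List A) f g → (∑[ x ∈ xs ] (f x + g x)) ≡ ∑ xs f + ∑ xs g
  ∑-+ []       f g = refl
  ∑-+ (x ∷ xs) f g = trans (+-congʳ (f x + g x) (∑-+ xs f g)) (+-interchange (f x) (g x) _ _)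

  ∑-*ˡ : ∀ (xs : List A) c f → (∑[ x ∈ xs ] c * f x) ≡ c * ∑ xs f
  ∑-*ˡ []       c f = sym (ℤ.*-zeroʳ c)
  ∑-*ˡ (x ∷ xs) c f = trans (+-congʳ (c * f x) (∑-*ˡ xs c f)) (sym (ℤ.*-distribˡ-+ c (f x) _))

  ∑-*ʳ : ∀ (xs : List A) c f → (∑[ x ∈ xs ] f x * c) ≡ ∑ xs f * c
  ∑-*ʳ xs c f = trans (∑-cong xs λ x → ℤ.*-comm (f x) c) (trans (∑-*ˡ xs c f) (ℤ.*-comm c _))

  ∑-const : ∀ (xs : List A) c → (∑[ x ∈ xs ] c) ≡ ∣ xs ∣ * c
  ∑-const []       c = refl
  ∑-const (x ∷ xs) c = trans (+-congʳ c (∑-const xs c)) (sym (ℤ.suc-* ∣ xs ∣ c))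

  ∑-0 : ∀ (xs : List A) → (∑[ x ∈ xs ] 0ℤ) ≡ 0ℤ
  ∑-0 xs = trans (∑-const xs 0ℤ) (ℤ.*-zeroʳ ∣ xs ∣)

  ∑-swap : ∀ (xs : List A) (ys : List B) (f : A → B → ℤ) →
           (∑[ x ∈ xs ] ∑[ y ∈ ys ] f x y) ≡ (∑[ y ∈ ys ] ∑[ x ∈ xs ] f x y)
  ∑-swap []       ys f = sym (∑-0 ys)
  ∑-swap (x ∷ xs) ys f =
    trans (+-congʳ (∑ ys (f x)) (∑-swap xs ys f)) (sym (∑-+ ys (f x) (λ y → ∑[ x ∈ xs ] f x y)))

  ∑-*-∑ : ∀ (xs : List A) (ys : List B) f g →
          ∑ xs f * ∑ ys g ≡ (∑[ x ∈ xs ] ∑[ y ∈ ys ] f x * g y)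
  ∑-*-∑ xs ys f g =
    trans (sym (∑-*ʳ xs (∑ ys g) f)) (∑-cong xs λ x → sym (∑-*ˡ ys (f x) g))

  -- Expands second moments: with `u` innermost, each pair `x`, `y` contributes a Gram entry that
  -- can be estimated by itself.
  ∑-bilinear : ∀ (us : List V) (xs : List A) (ys : List B) (f : V → A → ℤ) (g : V → B → ℤ) →
    (∑[ u ∈ us ] ∑ xs (f u) * ∑ ys (g u)) ≡
    (∑[ x ∈ xs ] ∑[ y ∈ ys ] ∑[ u ∈ us ] f u x * g u y)
  ∑-bilinear us xs ys f g =
    trans (∑-cong us λ u → ∑-*-∑ xs ys (f u) (g u))
    (trans (∑-swap us xs λ u x → ∑[ y ∈ ys ] f u x * g u y)
           (∑-cong xs λ x → ∑-swap us ys λ u y → f u x * g u y))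

  ∑-++ : ∀ (xs ys : List A) f → ∑ (xs ++ ys) f ≡ ∑ xs f + ∑ ys f
  ∑-++ []       ys f = sym (ℤ.+-identityˡ _)
  ∑-++ (x ∷ xs) ys f = trans (+-congʳ (f x) (∑-++ xs ys f)) (sym (ℤ.+-assoc (f x) _ _))

  ∑-map : ∀ (h : A → B) xs f → ∑ (map h xs) f ≡ (∑[ x ∈ xs ] f (h x))
  ∑-map h []       f = refl
  ∑-map h (x ∷ xs) f = +-congʳ (f (h x)) (∑-map h xs f)

  ∑-cartesianProductWith : ∀ (h : A → B → V) xs ys f →
    ∑ (cartesianProductWith h xs ys) f ≡ (∑[ x ∈ xs ] ∑[ y ∈ ys ] f (h x y))
  ∑-cartesianProductWith h []       ys f = refl
  ∑-cartesianProductWith h (x ∷ xs) ys f =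
    trans (∑-++ (map (h x) ys) _ f)
          (cong₂ _+_ (∑-map (h x) ys f) (∑-cartesianProductWith h xs ys f))

  ∣cartesianProductWith∣ : ∀ (h : A → B → V) xs ys →
    ∣ cartesianProductWith h xs ys ∣ ≡ ∣ xs ∣ * ∣ ys ∣
  ∣cartesianProductWith∣ h xs ys = begin
    ∣ zs ∣                                ≡⟨ ∑-1 zs ⟨
    (∑[ z ∈ zs ] 1ℤ)                      ≡⟨ ∑-cartesianProductWith h xs ys (λ _ → 1ℤ) ⟩
    (∑[ x ∈ xs ] ∑[ y ∈ ys ] 1ℤ)          ≡⟨ ∑-const xs _ ⟩
    ∣ xs ∣ * (∑[ y ∈ ys ] 1ℤ)             ≡⟨ cong (∣ xs ∣ *_) (∑-1 ys) ⟩
    ∣ xs ∣ * ∣ ys ∣                       ∎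
    where
    open ≡-Reasoning
    zs = cartesianProductWith h xs ys
    ∑-1 : ∀ {A : Set} (xs : List A) → (∑[ x ∈ xs ] 1ℤ) ≡ ∣ xs ∣
    ∑-1 xs = trans (∑-const xs 1ℤ) (ℤ.*-identityʳ ∣ xs ∣)

  term≤∑ : ∀ {xs : List A} {x} f → (∀ y → 0ℤ ≤ f y) → x ∈ xs → f x ≤ ∑ xs f
  term≤∑ {xs = x ∷ xs} f 0≤f (here refl) =
    ℤ.i≤i+j (f x) _ {{nonNegative (∑-nonneg xs 0≤f)}}
  term≤∑ {xs = x ∷ xs} f 0≤f (there x∈xs) =
    ℤ.i≤j⇒i≤k+j (f x) {{nonNegative (0≤f x)}} (term≤∑ f 0≤f x∈xs)

  +-sum : ∀ (f : A → ℕ) xs → + sum (map f xs) ≡ (∑[ x ∈ xs ] + f x)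
  +-sum f []       = refl
  +-sum f (x ∷ xs) = +-congʳ (+ f x) (+-sum f xs)

  ⟦_⟧ : Dec P → ℤ
  ⟦ yes _ ⟧ = 1ℤ
  ⟦ no  _ ⟧ = 0ℤ

  ⟦⟧-nonneg : (p? : Dec P) → 0ℤ ≤ ⟦ p? ⟧
  ⟦⟧-nonneg (yes _) = 0≤+
  ⟦⟧-nonneg (no  _) = 0≤+

  ⟦⟧-≤1 : (p? : Dec P) → ⟦ p? ⟧ ≤ 1ℤ
  ⟦⟧-≤1 (yes _) = ℤ.≤-refl
  ⟦⟧-≤1 (no  _) = 0≤+

  ⟦⟧-true : (p? : Dec P) → P → ⟦ p? ⟧ ≡ 1ℤ
  ⟦⟧-true (yes _) p = refl
  ⟦⟧-true (no ¬p) p = contradiction p ¬p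

  ⟦⟧-false : (p? : Dec P) → ¬ P → ⟦ p? ⟧ ≡ 0ℤ
  ⟦⟧-false (yes p) ¬p = contradiction p ¬p
  ⟦⟧-false (no _)  ¬p = refl

  ⟦⟧-cong : (p? : Dec P) (q? : Dec Q) → (P → Q) → (Q → P) → ⟦ p? ⟧ ≡ ⟦ q? ⟧
  ⟦⟧-cong (yes p) q? f g = sym (⟦⟧-true q? (f p))
  ⟦⟧-cong (no ¬p) q? f g = sym (⟦⟧-false q? λ q → ¬p (g q))

  ⟦⟧-× : (p? : Dec P) (q? : Dec Q) → ⟦ p? ⟧ * ⟦ q? ⟧ ≡ ⟦ p? ×-dec q? ⟧
  ⟦⟧-× (yes _) (yes _) = refl
  ⟦⟧-× (yes _) (no  _) = refl
  ⟦⟧-× (no  _) q?      = refl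

  +-length-filter : ∀ {P : A → Set} (P? : ∀ x → Dec (P x)) xs →
                    + length (filter P? xs) ≡ (∑[ x ∈ xs ] ⟦ P? x ⟧)
  +-length-filter P? []       = refl
  +-length-filter P? (x ∷ xs) with P? x
  ... | yes _ = +-congʳ 1ℤ (+-length-filter P? xs)
  ... | no  _ = trans (+-length-filter P? xs) (sym (ℤ.+-identityˡ _))

  record Enumeration (A : Set) : Set where
    field
      elements : List A
      unique   : Unique elements
      complete : ∀ x → x ∈ elements
  open Enumeration public

  count≤1 : ∀ {P : A → Set} (P? : ∀ x → Dec (P x)) {xs} → Unique xs →
            (∀ {x y} → P x → P y → x ≡ y) → (∑[ x ∈ xs ] ⟦ P? x ⟧) ≤ 1ℤ
  count≤1 P? []               !P = 0≤+
  count≤1 P? (_∷_ {x} x∉xs u) !P with P? x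
  ... | no  _  = ℤ.≤-trans (ℤ.≤-reflexive (ℤ.+-identityˡ _)) (count≤1 P? u !P)
  ... | yes px = ℤ.≤-reflexive (trans (+-congʳ 1ℤ (none x∉xs)) (ℤ.+-identityʳ 1ℤ))
    where
    none : ∀ {ys} → All (x ≢_) ys → (∑[ y ∈ ys ] ⟦ P? y ⟧) ≡ 0ℤ
    none []           = refl
    none (_∷_ {y} x≢y x∉ys) =
      trans (cong₂ _+_ (⟦⟧-false (P? y) λ py → x≢y (!P px py)) (none x∉ys)) refl

  1≤count : ∀ {P : A → Set} (P? : ∀ x → Dec (P x)) {xs x} → x ∈ xs → P x →
            1ℤ ≤ (∑[ x ∈ xs ] ⟦ P? x ⟧)
  1≤count P? {x = x} x∈xs px =
    ℤ.≤-trans (ℤ.≤-reflexive (sym (⟦⟧-true (P? x) px)))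
              (term≤∑ (λ x → ⟦ P? x ⟧) (λ x → ⟦⟧-nonneg (P? x)) x∈xs)

  count≡1 : ∀ {P : A → Set} (P? : ∀ x → Dec (P x)) (U : Enumeration A) x → P x →
            (∀ {y z} → P y → P z → y ≡ z) → (∑[ x ∈ elements U ] ⟦ P? x ⟧) ≡ 1ℤ
  count≡1 P? U x px !P = ℤ.≤-antisym (count≤1 P? (unique U) !P) (1≤count P? (complete U x) px)

  count-none : ∀ {P : A → Set} (P? : ∀ x → Dec (P x)) xs → (∀ x → ¬ P x) →
               (∑[ x ∈ xs ] ⟦ P? x ⟧) ≡ 0ℤ
  count-none P? xs ¬P = trans (∑-cong xs λ x → ⟦⟧-false (P? x) (¬P x)) (∑-0 xs)

  -- Double counting of the pairs `x`, `z` with `P x` and `φ x ≡ z`: every `x` satisfying `P` occurs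
  -- in one, and every `z` in at most one because `φ` is injective there.
  count≤codomain : ∀ {P : A → Set} (P? : ∀ x → Dec (P x)) {xs} → Unique xs →
    DecidableEquality B → (Z : Enumeration B) (φ : A → B) →
    (∀ {x y} → P x → P y → φ x ≡ φ y → x ≡ y) →
    (∑[ x ∈ xs ] ⟦ P? x ⟧) ≤ ∣ elements Z ∣
  count≤codomain {P = P} P? {xs} u _≟_ Z φ φ-inj = begin
    (∑[ x ∈ xs ] ⟦ P? x ⟧)                              ≤⟨ ∑-mono xs below ⟩
    (∑[ x ∈ xs ] ∑[ z ∈ zs ] ⟦ P? x ×-dec φ x ≟ z ⟧)    ≡⟨ ∑-swap xs zs (λ x z → ⟦ P? x ×-dec φ x ≟ z ⟧) ⟩
    (∑[ z ∈ zs ] ∑[ x ∈ xs ] ⟦ P? x ×-dec φ x ≟ z ⟧)    ≤⟨ ∑-mono zs above ⟩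
    (∑[ z ∈ zs ] 1ℤ)                                    ≡⟨ ∑-const zs 1ℤ ⟩
    ∣ zs ∣ * 1ℤ                                         ≡⟨ ℤ.*-identityʳ _ ⟩
    ∣ zs ∣                                              ∎
    where
    open ℤ.≤-Reasoning
    zs = elements Z
    below : ∀ x → ⟦ P? x ⟧ ≤ (∑[ z ∈ zs ] ⟦ P? x ×-dec φ x ≟ z ⟧)
    below x with P? x
    ... | yes px = 1≤count (λ z → yes px ×-dec φ x ≟ z) (complete Z (φ x)) (px , refl)
    ... | no ¬px = ∑-nonneg zs λ z → ⟦⟧-nonneg (no ¬px ×-dec φ x ≟ z)
    above : ∀ z → (∑[ x ∈ xs ] ⟦ P? x ×-dec φ x ≟ z ⟧) ≤ 1ℤ
    above z = count≤1 (λ x → P? x ×-dec φ x ≟ z) u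
      λ (px , φx≡z) (py , φy≡z) → φ-inj px py (trans φx≡z (sym φy≡z))

  -- Each `f y` is spread over the universe by the indicator of `y ≡ x`. After exchanging the sums,
  -- `f x` is taken at most once, since `ys` has no duplicates.
  ∑-subset : DecidableEquality A → (U : Enumeration A) → ∀ {ys} → Unique ys →
             ∀ f → (∀ x → 0ℤ ≤ f x) → ∑ ys f ≤ ∑ (elements U) f
  ∑-subset _≟_ U {ys} u f 0≤f = begin
    ∑ ys f                                      ≤⟨ ∑-mono ys below ⟩
    (∑[ y ∈ ys ] ∑[ x ∈ xs ] ⟦ y ≟ x ⟧ * f x)   ≡⟨ ∑-swap ys xs (λ y x → ⟦ y ≟ x ⟧ * f x) ⟩
    (∑[ x ∈ xs ] ∑[ y ∈ ys ] ⟦ y ≟ x ⟧ * f x)   ≤⟨ ∑-mono xs above ⟩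
    ∑ xs f                                      ∎
    where
    open ℤ.≤-Reasoning
    xs = elements U
    below : ∀ y → f y ≤ (∑[ x ∈ xs ] ⟦ y ≟ x ⟧ * f x)
    below y = begin
      f y               ≡⟨ ℤ.*-identityˡ (f y) ⟨
      1ℤ * f y          ≡⟨ cong (_* f y) (⟦⟧-true (y ≟ y) refl) ⟨
      ⟦ y ≟ y ⟧ * f y   ≤⟨ term≤∑ _ (λ x → 0≤-* (⟦⟧-nonneg (y ≟ x)) (0≤f x)) (complete U y) ⟩
      (∑[ x ∈ xs ] ⟦ y ≟ x ⟧ * f x) ∎
    above : ∀ x → (∑[ y ∈ ys ] ⟦ y ≟ x ⟧ * f x) ≤ f x
    above x = begin
      (∑[ y ∈ ys ] ⟦ y ≟ x ⟧ * f x)    ≡⟨ ∑-*ʳ ys (f x) _ ⟩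
      (∑[ y ∈ ys ] ⟦ y ≟ x ⟧) * f x    ≤⟨ *-monoʳ-≤ (f x) (0≤f x) (count≤1 (_≟ x) u λ p q → trans p (sym q)) ⟩
      1ℤ * f x                         ≡⟨ ℤ.*-identityˡ (f x) ⟩
      f x                              ∎

  length≤ : DecidableEquality A → (U : Enumeration A) → ∀ {ys} → Unique ys → ∣ ys ∣ ≤ ∣ elements U ∣
  length≤ _≟_ U {ys} u = begin
    ∣ ys ∣                         ≡⟨ ℤ.*-identityʳ _ ⟨
    ∣ ys ∣ * 1ℤ                    ≡⟨ ∑-const ys 1ℤ ⟨
    (∑[ y ∈ ys ] 1ℤ)               ≤⟨ ∑-subset _≟_ U u _ (λ _ → 0≤+) ⟩
    (∑[ x ∈ elements U ] 1ℤ)       ≡⟨ ∑-const (elements U) 1ℤ ⟩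
    ∣ elements U ∣ * 1ℤ            ≡⟨ ℤ.*-identityʳ _ ⟩
    ∣ elements U ∣                 ∎
    where open ℤ.≤-Reasoning

  ∑-affine : ∀ (xs : List A) n c f → (∑[ x ∈ xs ] (n * f x + c)) ≡ n * ∑ xs f + ∣ xs ∣ * c
  ∑-affine xs n c f = trans (∑-+ xs _ _) (cong₂ _+_ (∑-*ˡ xs n f) (∑-const xs c))

  -- Deviations from the mean are multiplied by `n`, which keeps everything in the integers.
  variance : ∀ (xs : List A) f → let n = ∣ xs ∣; T = ∑ xs f in
    (∑[ x ∈ xs ] (n * f x - T) * (n * f x - T)) ≡ n * (n * (∑[ x ∈ xs ] f x * f x) - T * T)
  variance xs f = begin
    (∑[ x ∈ xs ] (n * f x - T) * (n * f x - T))
      ≡⟨ ∑-cong xs (λ x → expand n (f x) T) ⟩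
    (∑[ x ∈ xs ] (n * (n * (f x * f x) + - (T + T) * f x) + T * T))
      ≡⟨ ∑-affine xs n (T * T) _ ⟩
    n * (∑[ x ∈ xs ] (n * (f x * f x) + - (T + T) * f x)) + n * (T * T)
      ≡⟨ cong (λ s → n * s + n * (T * T))
           (trans (∑-+ xs _ _) (cong₂ _+_ (∑-*ˡ xs n _) (∑-*ˡ xs (- (T + T)) f))) ⟩
    n * (n * (∑[ x ∈ xs ] f x * f x) + - (T + T) * T) + n * (T * T)
      ≡⟨ collect n (∑[ x ∈ xs ] f x * f x) T ⟩
    n * (n * (∑[ x ∈ xs ] f x * f x) - T * T) ∎
    where
    open ≡-Reasoning
    n = ∣ xs ∣
    T = ∑ xs f
    expand : ∀ n x T → (n * x + - T) * (n * x + - T) ≡ n * (n * (x * x) + - (T + T) * x) + T * T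
    expand = solve-∀
    collect : ∀ n s T → n * (n * s + - (T + T) * T) + n * (T * T) ≡ n * (n * s + - (T * T))
    collect = solve-∀

  -- The variance is nonnegative. Cancelling the length requires it to be positive, hence the
  -- separate case of the empty list.
  cauchy-schwarz : ∀ (xs : List A) f → ∑ xs f * ∑ xs f ≤ ∣ xs ∣ * (∑[ x ∈ xs ] f x * f x)
  cauchy-schwarz []          f = ℤ.≤-refl
  cauchy-schwarz xs@(_ ∷ _) f = ℤ.0≤i-j⇒j≤i (ℤ.*-cancelˡ-≤-pos _ _ ∣ xs ∣
    (subst₂ _≤_ (sym (ℤ.*-zeroʳ ∣ xs ∣)) (variance xs f) (∑-nonneg xs λ x → 0≤i*i (∣ xs ∣ * f x - ∑ xs f))))

  -- The expander mixing lemma without eigenvalues.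
  deviation : DecidableEquality A → (U : Enumeration A) → ∀ {ys} → Unique ys → ∀ f →
    let us = elements U; n = ∣ us ∣; T = ∑ us f; D = n * ∑ ys f - ∣ ys ∣ * T in
    D * D ≤ ∣ ys ∣ * (n * (n * (∑[ u ∈ us ] f u * f u) - T * T))
  deviation _≟_ U {ys} uniq f = begin
    D * D
      ≡⟨ cong₂ _*_ D-sum D-sum ⟩
    ∑ ys h * ∑ ys h
      ≤⟨ cauchy-schwarz ys h ⟩
    ∣ ys ∣ * (∑[ y ∈ ys ] h y * h y)
      ≤⟨ *-monoˡ-≤ ∣ ys ∣ 0≤+ (∑-subset _≟_ U uniq (λ x → h x * h x) (λ x → 0≤i*i (h x))) ⟩
    ∣ ys ∣ * (∑[ u ∈ us ] h u * h u)
      ≡⟨ cong (∣ ys ∣ *_) (variance us f) ⟩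
    ∣ ys ∣ * (n * (n * (∑[ u ∈ us ] f u * f u) - T * T)) ∎
    where
    open ℤ.≤-Reasoning
    us = elements U
    n = ∣ us ∣
    T = ∑ us f
    D = n * ∑ ys f - ∣ ys ∣ * T
    h = λ x → n * f x - T
    D-sum : D ≡ ∑ ys h
    D-sum = trans (+-congʳ (n * ∑ ys f) (ℤ.neg-distribʳ-* ∣ ys ∣ T)) (sym (∑-affine ys n (- T) f))

-- Nets of finite geometry and bounds for collinear pairs.

module Nets where
  open import Data.Integer.Base using (ℤ; +_; _+_; _*_; -_; _-_; _≤_; 0ℤ; 1ℤ; Positive; positive)
  open FiniteSums

  private variable
    V V₁ V₂ W Z Z₁ Z₂ : Set
    m m₁ m₂ : ℤ

  -- A net of order m in the sense of finite geometry, with parallel classes indexed by W: the lines of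
  -- the class w are the fibres of π w.
  record Net (W V Z : Set) (m : ℤ) : Set where
    field
      points      : Enumeration V
      _≟ᵛ_        : DecidableEquality V
      _≟ᶻ_        : DecidableEquality Z
      π           : W → V → Z
      ∣points∣    : ∣ elements points ∣ ≡ m * m
      fibre       : ∀ w x → (∑[ u ∈ elements points ] ⟦ π w u ≟ᶻ π w x ⟧) ≡ m
      transversal : ∀ {w w′} → w ≢ w′ → ∀ {x y} → π w x ≡ π w y → π w′ x ≡ π w′ y → x ≡ y

    same : W → V → V → ℤ
    same w x y = ⟦ π w x ≟ᶻ π w y ⟧

    pairs : List V → W → ℤ
    pairs xs w = ∑[ x ∈ xs ] ∑[ y ∈ xs ] same w x y

  ⟦⟧-≡-dec : (_≟₁_ : DecidableEquality Z₁) (_≟₂_ : DecidableEquality Z₂) → ∀ x y →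
    ⟦ ≡-dec _≟₁_ _≟₂_ x y ⟧ ≡ ⟦ proj₁ x ≟₁ proj₁ y ⟧ * ⟦ proj₂ x ≟₂ proj₂ y ⟧
  ⟦⟧-≡-dec _≟₁_ _≟₂_ x y =
    trans (⟦⟧-cong (≡-dec _≟₁_ _≟₂_ x y) (proj₁ x ≟₁ proj₁ y ×-dec proj₂ x ≟₂ proj₂ y)
            (λ { refl → refl , refl }) (λ (p , q) → cong₂ _,_ p q))
          (sym (⟦⟧-× (proj₁ x ≟₁ proj₁ y) (proj₂ x ≟₂ proj₂ y)))

  -- Replaces one of two conditions on a summation point by a condition that no longer involves it
  -- and so leaves the sum as a factor.
  ⟦⟧-≡-trans : (_≟_ : DecidableEquality Z) → ∀ x y z → ⟦ x ≟ y ⟧ * ⟦ x ≟ z ⟧ ≡ ⟦ x ≟ y ⟧ * ⟦ y ≟ z ⟧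
  ⟦⟧-≡-trans _≟_ x y z with x ≟ y
  ... | yes refl = refl
  ... | no _     = refl

  enumeration-× : Enumeration V₁ → Enumeration V₂ → (pair : V₁ → V₂ → V) (fst : V → V₁) (snd : V → V₂) →
    (∀ a b → fst (pair a b) ≡ a) → (∀ a b → snd (pair a b) ≡ b) → (∀ x → pair (fst x) (snd x) ≡ x) →
    Enumeration V
  enumeration-× U₁ U₂ pair fst snd fst-pair snd-pair pair-η = record
    { elements = cartesianProductWith pair (elements U₁) (elements U₂)
    ; unique   = Unique.cartesianProductWith⁺ pair
        (λ {a} {a′} {b} {b′} eq → trans (sym (fst-pair a b)) (trans (cong fst eq) (fst-pair a′ b′))
                                , trans (sym (snd-pair a b)) (trans (cong snd eq) (snd-pair a′ b′)))
        (unique U₁) (unique U₂)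
    ; complete = λ x → subst (_∈ _) (pair-η x)
        (∈-cartesianProductWith⁺ pair (complete U₁ (fst x)) (complete U₂ (snd x)))
    }

  -- Both factors are projected in the same direction, so fibre sizes multiply and transversality is
  -- inherited factor by factor. The pairing maps are explicit because `V` need not be a product
  -- type: a matrix is treated as a pair of rows.
  net-× : Net W V₁ Z₁ m₁ → Net W V₂ Z₂ m₂ → DecidableEquality V →
    (pair : V₁ → V₂ → V) (fst : V → V₁) (snd : V → V₂) →
    (∀ a b → fst (pair a b) ≡ a) → (∀ a b → snd (pair a b) ≡ b) → (∀ x → pair (fst x) (snd x) ≡ x) →
    Net W V (Z₁ × Z₂) (m₁ * m₂)
  net-× {m₁ = m₁} {m₂ = m₂} 𝒩₁ 𝒩₂ _≟_ pair fst snd fst-pair snd-pair pair-η = record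
    { points      = enumeration-× A.points B.points pair fst snd fst-pair snd-pair pair-η
    ; _≟ᵛ_        = _≟_
    ; _≟ᶻ_        = ≡-dec A._≟ᶻ_ B._≟ᶻ_
    ; π           = λ w x → A.π w (fst x) , B.π w (snd x)
    ; ∣points∣    = trans (∣cartesianProductWith∣ pair as bs)
                    (trans (cong₂ _*_ A.∣points∣ B.∣points∣) (*-interchange m₁ m₂))
    ; fibre       = fibre
    ; transversal = λ w≢w′ {x} {y} p q → trans (sym (pair-η x)) (trans
        (cong₂ pair (A.transversal w≢w′ (cong proj₁ p) (cong proj₁ q))
                    (B.transversal w≢w′ (cong proj₂ p) (cong proj₂ q)))
        (pair-η y))
    }
    where
    module A = Net 𝒩₁
    module B = Net 𝒩₂
    as = elements A.points
    bs = elements B.points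
    *-interchange : ∀ i j → (i * i) * (j * j) ≡ (i * j) * (i * j)
    *-interchange = solve-∀
    π = λ w x → A.π w (fst x) , B.π w (snd x)
    _≟ᶻ_ = ≡-dec A._≟ᶻ_ B._≟ᶻ_
    fibre : ∀ w x → (∑[ u ∈ cartesianProductWith pair as bs ] ⟦ π w u ≟ᶻ π w x ⟧) ≡ m₁ * m₂
    fibre w x = begin
      (∑[ u ∈ cartesianProductWith pair as bs ] ⟦ π w u ≟ᶻ π w x ⟧)
        ≡⟨ ∑-cartesianProductWith pair as bs _ ⟩
      (∑[ a ∈ as ] ∑[ b ∈ bs ] ⟦ π w (pair a b) ≟ᶻ π w x ⟧)
        ≡⟨ ∑-cong as (λ a → ∑-cong bs (λ b → split a b)) ⟩
      (∑[ a ∈ as ] ∑[ b ∈ bs ] A.same w a (fst x) * B.same w b (snd x))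
        ≡⟨ ∑-*-∑ as bs (λ a → A.same w a (fst x)) (λ b → B.same w b (snd x)) ⟨
      (∑[ a ∈ as ] A.same w a (fst x)) * (∑[ b ∈ bs ] B.same w b (snd x))
        ≡⟨ cong₂ _*_ (A.fibre w (fst x)) (B.fibre w (snd x)) ⟩
      m₁ * m₂ ∎
      where
      open ≡-Reasoning
      split : ∀ a b → ⟦ π w (pair a b) ≟ᶻ π w x ⟧ ≡ A.same w a (fst x) * B.same w b (snd x)
      split a b rewrite fst-pair a b | snd-pair a b = ⟦⟧-≡-dec A._≟ᶻ_ B._≟ᶻ_ _ _

  module SecondMoment (𝒩 : Net W V Z m) where
    open Net 𝒩

    us : List V
    us = elements points

    class : List V → W → V → ℤ
    class xs w u = ∑[ x ∈ xs ] same w u x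

    ∑-class : ∀ xs w → ∑ us (class xs w) ≡ ∣ xs ∣ * m
    ∑-class xs w = trans (∑-swap us xs (same w)) (trans (∑-cong xs (fibre w)) (∑-const xs m))

    -- The sum runs over points instead of lines, so each line is counted once for each of its `m`
    -- points.
    ∑-class² : ∀ xs w → (∑[ u ∈ us ] class xs w u * class xs w u) ≡ m * pairs xs w
    ∑-class² xs w = begin
      (∑[ u ∈ us ] class xs w u * class xs w u)
        ≡⟨ ∑-bilinear us xs xs (same w) (same w) ⟩
      (∑[ x ∈ xs ] ∑[ y ∈ xs ] ∑[ u ∈ us ] same w u x * same w u y)
        ≡⟨ ∑-cong xs (λ x → trans (∑-cong xs (inner x)) (∑-*ˡ xs m (same w x))) ⟩
      (∑[ x ∈ xs ] m * (∑[ y ∈ xs ] same w x y))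
        ≡⟨ ∑-*ˡ xs m _ ⟩
      m * pairs xs w ∎
      where
      open ≡-Reasoning
      inner : ∀ x y → (∑[ u ∈ us ] same w u x * same w u y) ≡ m * same w x y
      inner x y = begin
        (∑[ u ∈ us ] same w u x * same w u y) ≡⟨ ∑-cong us (λ u → ⟦⟧-≡-trans _≟ᶻ_ (π w u) (π w x) (π w y)) ⟩
        (∑[ u ∈ us ] same w u x * same w x y) ≡⟨ ∑-*ʳ us (same w x y) (λ u → same w u x) ⟩
        (∑[ u ∈ us ] same w u x) * same w x y ≡⟨ cong (_* same w x y) (fibre w x) ⟩
        m * same w x y                        ∎

    -- Lines of different classes meet in at most one point, so each pair `x`, `y` is seen by at
    -- most one `u`.
    ∑-class-class : ∀ xs {w w′} → w ≢ w′ →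
      (∑[ u ∈ us ] class xs w u * class xs w′ u) ≤ ∣ xs ∣ * ∣ xs ∣
    ∑-class-class xs {w} {w′} w≢w′ = begin
      (∑[ u ∈ us ] class xs w u * class xs w′ u)
        ≡⟨ ∑-bilinear us xs xs (same w) (same w′) ⟩
      (∑[ x ∈ xs ] ∑[ y ∈ xs ] ∑[ u ∈ us ] same w u x * same w′ u y)
        ≤⟨ ∑-mono xs (λ x → ∑-mono xs (inner x)) ⟩
      (∑[ x ∈ xs ] ∑[ y ∈ xs ] 1ℤ)
        ≡⟨ trans (∑-const xs _) (cong (∣ xs ∣ *_) (trans (∑-const xs 1ℤ) (ℤ.*-identityʳ _))) ⟩
      ∣ xs ∣ * ∣ xs ∣ ∎
      where
      open ℤ.≤-Reasoning
      inner : ∀ x y → (∑[ u ∈ us ] same w u x * same w′ u y) ≤ 1ℤ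
      inner x y = begin
        (∑[ u ∈ us ] same w u x * same w′ u y)
          ≡⟨ ∑-cong us (λ u → ⟦⟧-× (π w u ≟ᶻ π w x) (π w′ u ≟ᶻ π w′ y)) ⟩
        (∑[ u ∈ us ] ⟦ π w u ≟ᶻ π w x ×-dec π w′ u ≟ᶻ π w′ y ⟧)
          ≤⟨ count≤1 (λ u → π w u ≟ᶻ π w x ×-dec π w′ u ≟ᶻ π w′ y) (unique points)
               (λ (p , q) (p′ , q′) → transversal w≢w′ (trans p (sym p′)) (trans q (sym q′))) ⟩
        1ℤ ∎

    module _ {{m>0 : Positive m}} where

      -- Cauchy-Schwarz over the `m` lines of one class. It is carried out over the points, where
      -- every line is repeated `m` times; this explains the two cancelled factors `m`.
      pairs-lower : ∀ xs w → ∣ xs ∣ * ∣ xs ∣ ≤ m * pairs xs w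
      pairs-lower xs w = ℤ.*-cancelˡ-≤-pos _ _ m (ℤ.*-cancelˡ-≤-pos _ _ m (begin
        m * (m * (∣ xs ∣ * ∣ xs ∣))                              ≡⟨ rearrange m ∣ xs ∣ ⟩
        (∣ xs ∣ * m) * (∣ xs ∣ * m)                              ≡⟨ cong₂ _*_ (∑-class xs w) (∑-class xs w) ⟨
        ∑ us (class xs w) * ∑ us (class xs w)                    ≤⟨ cauchy-schwarz us (class xs w) ⟩
        ∣ us ∣ * (∑[ u ∈ us ] class xs w u * class xs w u)       ≡⟨ cong₂ _*_ ∣points∣ (∑-class² xs w) ⟩
        m * m * (m * pairs xs w)                                 ≡⟨ ℤ.*-assoc m m _ ⟩
        m * (m * (m * pairs xs w))                               ∎))
        where
        open ℤ.≤-Reasoning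
        rearrange : ∀ i j → i * (i * (j * j)) ≡ (j * i) * (j * i)
        rearrange = solve-∀

      -- The mean of the left side is ∣ 𝕎 ∣ * ∣ xs ∣ ²; the point is that summing over w costs nothing in
      -- the error term, which is the bound for one w.
      pairs-upper : (𝕎 : Enumeration W) → DecidableEquality W → ∀ {xs} → Unique xs →
        m * (∑[ w ∈ elements 𝕎 ] pairs xs w) ≤
        ∣ elements 𝕎 ∣ * (∣ xs ∣ * ∣ xs ∣) + m * m * ∣ xs ∣
      pairs-upper 𝕎 _≟ʷ_ {xs} uniq = conclude
        where
        open ℤ.≤-Reasoning
        ws = elements 𝕎
        n = ∣ xs ∣
        k = ∣ ws ∣
        S = ∑[ w ∈ ws ] pairs xs w
        g = λ u → ∑[ w ∈ ws ] class xs w u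
        -- The excess over the main term. The variance of `g` turns out to be bounded by a multiple
        -- of `E` itself, so the deviation estimate bounds `E * E` by a multiple of `E`.
        E = m * S - k * (n * n)

        cross = λ w w′ → ∑[ u ∈ us ] class xs w u * class xs w′ u

        -- One inequality for both cases: equality when `w ≡ w′`, and `∑-class-class` otherwise. The
        -- term `n * n` on the left compensates on the diagonal for the one on the right.
        cross-bound : ∀ w w′ → cross w w′ + ⟦ w ≟ʷ w′ ⟧ * (n * n) ≤ ⟦ w ≟ʷ w′ ⟧ * (m * pairs xs w) + n * n
        cross-bound w w′ with w ≟ʷ w′
        ... | yes refl = ℤ.≤-reflexive (cong₂ _+_
          (trans (∑-class² xs w) (sym (ℤ.*-identityˡ (m * pairs xs w)))) (ℤ.*-identityˡ (n * n)))
        ... | no w≢w′  = begin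
          cross w w′ + 0ℤ  ≡⟨ ℤ.+-identityʳ _ ⟩
          cross w w′       ≤⟨ ∑-class-class xs w≢w′ ⟩
          n * n            ≡⟨ ℤ.+-identityˡ _ ⟨
          0ℤ + n * n       ∎

        diagonal : ∀ w c → (∑[ w′ ∈ ws ] ⟦ w ≟ʷ w′ ⟧ * c) ≡ c
        diagonal w c = trans (∑-*ʳ ws c (λ w′ → ⟦ w ≟ʷ w′ ⟧))
          (trans (cong (_* c) (count≡1 (w ≟ʷ_) 𝕎 w refl (λ p q → trans (sym p) q))) (ℤ.*-identityˡ c))

        G = ∑[ u ∈ us ] g u * g u

        G-bound : G + k * (n * n) ≤ m * S + k * (k * (n * n))
        G-bound = begin
          G + k * (n * n)
            ≡⟨ cong₂ _+_ (∑-bilinear us ws ws (λ u w → class xs w u) (λ u w → class xs w u))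
                         (sym (∑-const ws (n * n))) ⟩
          (∑[ w ∈ ws ] ∑ ws (cross w)) + (∑[ w ∈ ws ] n * n)
            ≡⟨ ∑-+ ws (λ w → ∑ ws (cross w)) (λ _ → n * n) ⟨
          (∑[ w ∈ ws ] (∑ ws (cross w) + n * n))
            ≡⟨ ∑-cong ws (λ w → trans (+-congʳ (∑ ws (cross w)) (sym (diagonal w (n * n))))
                                      (sym (∑-+ ws (cross w) (λ w′ → ⟦ w ≟ʷ w′ ⟧ * (n * n))))) ⟩
          (∑[ w ∈ ws ] ∑[ w′ ∈ ws ] (cross w w′ + ⟦ w ≟ʷ w′ ⟧ * (n * n)))
            ≤⟨ ∑-mono ws (λ w → ∑-mono ws (cross-bound w)) ⟩
          (∑[ w ∈ ws ] ∑[ w′ ∈ ws ] (⟦ w ≟ʷ w′ ⟧ * (m * pairs xs w) + n * n))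
            ≡⟨ ∑-cong ws (λ w → trans (∑-+ ws (λ w′ → ⟦ w ≟ʷ w′ ⟧ * (m * pairs xs w)) (λ _ → n * n))
                 (cong₂ _+_ (diagonal w (m * pairs xs w)) (∑-const ws (n * n)))) ⟩
          (∑[ w ∈ ws ] (m * pairs xs w + k * (n * n)))
            ≡⟨ ∑-affine ws m (k * (n * n)) (pairs xs) ⟩
          m * S + k * (k * (n * n)) ∎

        T≡ : ∑ us g ≡ k * (n * m)
        T≡ = trans (∑-swap us ws (λ u w → class xs w u))
                   (trans (∑-cong ws (∑-class xs)) (∑-const ws (n * m)))

        -- The list `xs` is used twice: `g` counts collinearities with `xs`, and summing `g` over
        -- `xs` again gives the collinear pairs.
        ∑g≡S : ∑ xs g ≡ S
        ∑g≡S = ∑-swap xs ws (λ u w → class xs w u)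

        D≡ : ∣ us ∣ * ∑ xs g - n * ∑ us g ≡ m * E
        D≡ = trans (cong₂ _-_ (cong₂ _*_ ∣points∣ ∑g≡S) (cong (n *_) T≡)) (eq m S n k)
          where
          eq : ∀ m S n k → m * m * S + - (n * (k * (n * m))) ≡ m * (m * S + - (k * (n * n)))
          eq = solve-∀

        variance-bound : ∣ us ∣ * G - ∑ us g * ∑ us g ≤ m * m * E
        variance-bound = begin
          ∣ us ∣ * G - ∑ us g * ∑ us g
            ≡⟨ cong₂ _-_ (cong (_* G) ∣points∣) (cong₂ _*_ T≡ T≡) ⟩
          m * m * G - k * (n * m) * (k * (n * m))
            ≤⟨ ≤-from-difference (*-monoˡ-≤ (m * m) (0≤i*i m) G-bound) (eq m G S n k) ⟩
          m * m * E ∎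
          where
          eq : ∀ m G S n k →
            m * m * (m * S + k * (k * (n * n))) + - (m * m * (G + k * (n * n))) ≡
            m * m * (m * S + - (k * (n * n))) + - (m * m * G + - (k * (n * m) * (k * (n * m))))
          eq = solve-∀

        E²-bound : m * m * (E * E) ≤ m * m * (m * m * n * E)
        E²-bound = begin
          m * m * (E * E)
            ≡⟨ eq₁ m E ⟩
          (m * E) * (m * E)
            ≡⟨ cong₂ _*_ D≡ D≡ ⟨
          (∣ us ∣ * ∑ xs g - n * ∑ us g) * (∣ us ∣ * ∑ xs g - n * ∑ us g)
            ≤⟨ deviation _≟ᵛ_ points uniq g ⟩
          n * (∣ us ∣ * (∣ us ∣ * G - ∑ us g * ∑ us g))
            ≤⟨ *-monoˡ-≤ n 0≤+ (*-monoˡ-≤ ∣ us ∣ 0≤+ variance-bound) ⟩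
          n * (∣ us ∣ * (m * m * E))
            ≡⟨ trans (cong (λ c → n * (c * (m * m * E))) ∣points∣) (eq₂ m n E) ⟩
          m * m * (m * m * n * E) ∎
          where
          eq₁ : ∀ m E → m * m * (E * E) ≡ (m * E) * (m * E)
          eq₁ = solve-∀
          eq₂ : ∀ m n E → n * (m * m * (m * m * E)) ≡ m * m * (m * m * n * E)
          eq₂ = solve-∀

        -- A factor `E` is cancelled from `E²-bound`, which requires `E` to be positive; for other
        -- `E` the bound is trivial.
        E-bound : E ≤ m * m * n
        E-bound with E ℤ.≤? 0ℤ
        ... | yes E≤0 = ℤ.≤-trans E≤0 (0≤-* (0≤i*i m) 0≤+)
        ... | no  E≰0 = ℤ.*-cancelʳ-≤-pos _ _ E {{positive (ℤ.≰⇒> E≰0)}}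
          (ℤ.*-cancelˡ-≤-pos _ _ m (ℤ.*-cancelˡ-≤-pos _ _ m
            (subst₂ _≤_ (ℤ.*-assoc m m (E * E)) (ℤ.*-assoc m m (m * m * n * E)) E²-bound)))

        conclude : m * S ≤ k * (n * n) + m * m * n
        conclude = ≤-from-difference E-bound (eq m S n k)
          where
          eq : ∀ m S n k → m * m * n + - (m * S + - (k * (n * n))) ≡ k * (n * n) + m * m * n + - (m * S)
          eq = solve-∀

-- Rows, directions and 2 by 2 matrices over the field.

module LinearAlgebra {q : ℕ} (F : FiniteField q) where
  open FiniteField F using (Carrier; isCommutativeRing; inverse; _≟_)
  open M2 F

  𝔽-ring : CommutativeRing 0ℓ 0ℓ
  𝔽-ring = record { isCommutativeRing = isCommutativeRing }

  open CommutativeRing 𝔽-ring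
    using (_+_; _*_; -_; 0#; 1#; +-assoc; +-identityʳ; +-identityˡ; *-assoc; *-identityˡ; *-identityʳ;
           zeroʳ; -‿inverseˡ; -‿inverseʳ; commutativeSemiring; +-group)
  open GroupProperties +-group using () renaming (∙-cancelˡ to +-cancelˡ; ∙-cancelʳ to +-cancelʳ)
  open SemiringSolver commutativeSemiring using (solve; _:=_; _:+_; _:*_)
  open ≡-Reasoning

  *-cancelʳ : ∀ {e} → e ≢ 0# → ∀ x y → x * e ≡ y * e → x ≡ y
  *-cancelʳ {e} e≢0 x y xe≡ye with e⁻¹ , ee⁻¹≡1 ← inverse e e≢0 =
    trans (sym (undo x)) (trans (cong (_* e⁻¹) xe≡ye) (undo y))
    where
    undo : ∀ z → z * e * e⁻¹ ≡ z
    undo z = trans (*-assoc z e e⁻¹) (trans (cong (z *_) ee⁻¹≡1) (*-identityʳ z))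

  -- Differences enter in the form `x ≡ y + e`. Matching on this equation eliminates `x`, and the
  -- identities that remain are subtraction-free, within reach of the semiring solver.
  difference : ∀ x y → ∃ λ e → x ≡ y + e
  difference x y = - y + x ,
    sym (trans (sym (+-assoc y (- y) x)) (trans (cong (_+ x) (-‿inverseʳ y)) (+-identityˡ x)))

  -- The witness is `t` = -x/y: the row with entries `x`, `y` vanishes in the direction `just t`.
  root : ∀ x {y} → y ≢ 0# → ∃ λ t → x + y * t ≡ 0#
  root x {y} y≢0 with y⁻¹ , yy⁻¹≡1 ← inverse y y≢0 = y⁻¹ * - x , (begin
    x + y * (y⁻¹ * - x)  ≡⟨ cong (x +_) (sym (*-assoc y y⁻¹ (- x))) ⟩
    x + y * y⁻¹ * - x    ≡⟨ cong (λ c → x + c * - x) yy⁻¹≡1 ⟩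
    x + 1# * - x         ≡⟨ cong (x +_) (*-identityˡ (- x)) ⟩
    x + - x              ≡⟨ -‿inverseʳ x ⟩
    0#                   ∎)

  Row : Set
  Row = Carrier × Carrier

  row₁ row₂ : Mat → Row
  row₁ (mat a b _ _) = a , b
  row₂ (mat _ _ c d) = c , d

  fromRows : Row → Row → Mat
  fromRows (a , b) (c , d) = mat a b c d

  -- just t and nothing are the points (1 : t) and (0 : 1) of the projective line.
  Direction : Set
  Direction = Maybe Carrier

  _·_ : Row → Direction → Carrier
  (x₁ , x₂) · just t  = x₁ + x₂ * t
  (x₁ , x₂) · nothing = x₂

  -- Two distinct directions form a basis, so the two values determine a row. For slopes `t` and
  -- `t + e`, subtracting the conditions leaves x₂ e = y₂ e with `e` nonzero.
  ·-transversal : ∀ {w w′} → w ≢ w′ → ∀ {x y} → x · w ≡ y · w → x · w′ ≡ y · w′ → x ≡ y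
  ·-transversal {nothing} {nothing} w≢w′ p q = contradiction refl w≢w′
  ·-transversal {nothing} {just t} w≢w′ {x₁ , x₂} {y₁ , .x₂} refl q =
    cong (_, x₂) (+-cancelʳ (x₂ * t) x₁ y₁ q)
  ·-transversal {just t} {nothing} w≢w′ {x₁ , x₂} {y₁ , .x₂} p refl =
    cong (_, x₂) (+-cancelʳ (x₂ * t) x₁ y₁ p)
  ·-transversal {just t} {just t′} w≢w′ {x₁ , x₂} {y₁ , y₂} p q
    with e , refl ← difference t′ t = cong₂ _,_ x₁≡y₁ x₂≡y₂
    where
    e≢0 : e ≢ 0#
    e≢0 refl = w≢w′ (cong just (sym (+-identityʳ t)))
    shift : ∀ z₁ z₂ → z₁ + z₂ * (t + e) ≡ (z₁ + z₂ * t) + z₂ * e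
    shift z₁ z₂ = solve 4 (λ z₁ z₂ t e → z₁ :+ z₂ :* (t :+ e) := (z₁ :+ z₂ :* t) :+ z₂ :* e) refl z₁ z₂ t e
    x₂≡y₂ : x₂ ≡ y₂
    x₂≡y₂ = *-cancelʳ e≢0 x₂ y₂ (+-cancelˡ (x₁ + x₂ * t) _ _ (begin
      (x₁ + x₂ * t) + x₂ * e  ≡⟨ shift x₁ x₂ ⟨
      x₁ + x₂ * (t + e)       ≡⟨ q ⟩
      y₁ + y₂ * (t + e)       ≡⟨ shift y₁ y₂ ⟩
      (y₁ + y₂ * t) + y₂ * e  ≡⟨ cong (_+ y₂ * e) p ⟨
      (x₁ + x₂ * t) + y₂ * e  ∎))
    x₁≡y₁ : x₁ ≡ y₁
    x₁≡y₁ = +-cancelʳ (x₂ * t) x₁ y₁ (trans p (cong (λ c → y₁ + c * t) (sym x₂≡y₂)))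

  _+ᵣ_ : Row → Row → Row
  (x₁ , x₂) +ᵣ (y₁ , y₂) = x₁ + y₁ , x₂ + y₂

  +ᵣ-cancelˡ : ∀ x y z → x +ᵣ y ≡ x +ᵣ z → y ≡ z
  +ᵣ-cancelˡ (x₁ , x₂) (y₁ , y₂) (z₁ , z₂) eq =
    cong₂ _,_ (+-cancelˡ x₁ y₁ z₁ (cong proj₁ eq)) (+-cancelˡ x₂ y₂ z₂ (cong proj₂ eq))

  _*ᵣ_ : Row → Mat → Row
  (x₁ , x₂) *ᵣ mat p₁ p₂ p₃ p₄ = x₁ * p₁ + x₂ * p₃ , x₁ * p₂ + x₂ * p₄

  ·-+ᵣ : ∀ x y w → (x +ᵣ y) · w ≡ x · w + y · w
  ·-+ᵣ (x₁ , x₂) (y₁ , y₂) nothing  = refl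
  ·-+ᵣ (x₁ , x₂) (y₁ , y₂) (just t) =
    solve 5 (λ x₁ x₂ y₁ y₂ t → (x₁ :+ y₁) :+ (x₂ :+ y₂) :* t := (x₁ :+ x₂ :* t) :+ (y₁ :+ y₂ :* t))
      refl x₁ x₂ y₁ y₂ t

  -- Associativity, (x P) w = x (P w), with `w` read as a column vector.
  ·-*ᵣ : ∀ x P w → (x *ᵣ P) · w ≡ proj₁ x * (row₁ P · w) + proj₂ x * (row₂ P · w)
  ·-*ᵣ (x₁ , x₂) (mat p₁ p₂ p₃ p₄) nothing  = refl
  ·-*ᵣ (x₁ , x₂) (mat p₁ p₂ p₃ p₄) (just t) =
    solve 7 (λ x₁ x₂ p₁ p₂ p₃ p₄ t →
      (x₁ :* p₁ :+ x₂ :* p₃) :+ (x₁ :* p₂ :+ x₂ :* p₄) :* t :=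
      x₁ :* (p₁ :+ p₂ :* t) :+ x₂ :* (p₃ :+ p₄ :* t)) refl x₁ x₂ p₁ p₂ p₃ p₄ t

  -- Singularity is expressed by a killed direction instead of a determinant, because that same `w`
  -- indexes the fibre in which the pairs are then counted.
  Kills : Mat → Direction → Set
  Kills P w = row₁ P · w ≡ 0# × row₂ P · w ≡ 0#

  kills? : ∀ P w → Dec (Kills P w)
  kills? P w = (row₁ P · w) ≟ 0# ×-dec (row₂ P · w) ≟ 0#

  Kills-*ᵣ : ∀ x P w → Kills P w → (x *ᵣ P) · w ≡ 0#
  Kills-*ᵣ x@(x₁ , x₂) P w (p , q) = begin
    (x *ᵣ P) · w                               ≡⟨ ·-*ᵣ x P w ⟩
    x₁ * (row₁ P · w) + x₂ * (row₂ P · w)      ≡⟨ cong₂ (λ u v → x₁ * u + x₂ * v) p q ⟩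
    x₁ * 0# + x₂ * 0#                          ≡⟨ cong₂ _+_ (zeroʳ x₁) (zeroʳ x₂) ⟩
    0# + 0#                                    ≡⟨ +-identityʳ 0# ⟩
    0#                                         ∎

  -- If P w = (0 , u) with u ≠ 0, applying both sides of x P = y P to w compares the second
  -- coordinates of x and y; similarly for P w = (u , 0).
  nonsingular⇒injective : ∀ P → (∀ w → ¬ Kills P w) → ∀ x y → x *ᵣ P ≡ y *ᵣ P → x ≡ y
  nonsingular⇒injective P@(mat p₁ p₂ p₃ p₄) ¬kills x@(x₁ , x₂) y@(y₁ , y₂) eq with p₂ ≟ 0# | p₄ ≟ 0#
  -- The second column of `P` is zero, so `P` kills (0 : 1).
  ... | yes p₂≡0 | yes p₄≡0 = contradiction (p₂≡0 , p₄≡0) (¬kills nothing)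
  ... | no p₂≢0 | _ with t , root-t ← root p₁ p₂≢0 = cong₂ _,_ x₁≡y₁ x₂≡y₂
    where
    u = p₃ + p₄ * t
    u≢0 : u ≢ 0#
    u≢0 u≡0 = ¬kills (just t) (root-t , u≡0)
    apply : ∀ z → (z *ᵣ P) · just t ≡ proj₂ z * u
    apply z@(z₁ , z₂) = trans (·-*ᵣ z P (just t)) (trans (cong (λ c → z₁ * c + z₂ * u) root-t)
      (trans (cong (_+ z₂ * u) (zeroʳ z₁)) (+-identityˡ (z₂ * u))))
    x₂≡y₂ : x₂ ≡ y₂
    x₂≡y₂ = *-cancelʳ u≢0 x₂ y₂ (trans (sym (apply x)) (trans (cong (_· just t) eq) (apply y)))
    x₁≡y₁ : x₁ ≡ y₁
    x₁≡y₁ = *-cancelʳ p₂≢0 x₁ y₁ (+-cancelʳ (x₂ * p₄) _ _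
      (trans (cong proj₂ eq) (cong (λ c → y₁ * p₂ + c * p₄) (sym x₂≡y₂))))
  ... | yes _ | no p₄≢0 with t , root-t ← root p₃ p₄≢0 = cong₂ _,_ x₁≡y₁ x₂≡y₂
    where
    u = p₁ + p₂ * t
    u≢0 : u ≢ 0#
    u≢0 u≡0 = ¬kills (just t) (u≡0 , root-t)
    apply : ∀ z → (z *ᵣ P) · just t ≡ proj₁ z * u
    apply z@(z₁ , z₂) = trans (·-*ᵣ z P (just t)) (trans (cong (λ c → z₁ * u + z₂ * c) root-t)
      (trans (cong (z₁ * u +_) (zeroʳ z₂)) (+-identityʳ (z₁ * u))))
    x₁≡y₁ : x₁ ≡ y₁
    x₁≡y₁ = *-cancelʳ u≢0 x₁ y₁ (trans (sym (apply x)) (trans (cong (_· just t) eq) (apply y)))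
    x₂≡y₂ : x₂ ≡ y₂
    x₂≡y₂ = *-cancelʳ p₄≢0 x₂ y₂ (+-cancelˡ (x₁ * p₂) _ _
      (trans (cong proj₂ eq) (cong (λ c → c * p₂ + y₂ * p₄) (sym x₁≡y₁))))

  0ᴹ : Mat
  0ᴹ = mat 0# 0# 0# 0#

  -- A nonzero entry in one row of `P` recovers the coordinate of `x` multiplying it from x P and
  -- the other coordinate, which is the one returned. The choice depends on `P` alone, so it serves
  -- for both rows of a matrix.
  nonzero⇒coordinate : ∀ P → P ≢ 0ᴹ → ∃ λ (coord : Row → Carrier) →
    ∀ x y → x *ᵣ P ≡ y *ᵣ P → coord x ≡ coord y → x ≡ y
  nonzero⇒coordinate (mat p₁ p₂ p₃ p₄) P≢0 with p₁ ≟ 0# | p₂ ≟ 0# | p₃ ≟ 0# | p₄ ≟ 0#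
  ... | yes refl | yes refl | yes refl | yes refl = contradiction refl P≢0
  ... | no p₁≢0 | _ | _ | _ = proj₂ , λ { (x₁ , x₂) (y₁ , .x₂) eq refl →
    cong (_, x₂) (*-cancelʳ p₁≢0 x₁ y₁ (+-cancelʳ (x₂ * p₃) _ _ (cong proj₁ eq))) }
  ... | yes _ | no p₂≢0 | _ | _ = proj₂ , λ { (x₁ , x₂) (y₁ , .x₂) eq refl →
    cong (_, x₂) (*-cancelʳ p₂≢0 x₁ y₁ (+-cancelʳ (x₂ * p₄) _ _ (cong proj₂ eq))) }
  ... | yes _ | yes _ | no p₃≢0 | _ = proj₁ , λ { (x₁ , x₂) (.x₁ , y₂) eq refl →
    cong (x₁ ,_) (*-cancelʳ p₃≢0 x₂ y₂ (+-cancelˡ (x₁ * p₁) _ _ (cong proj₁ eq))) }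
  ... | yes _ | yes _ | yes _ | no p₄≢0 = proj₁ , λ { (x₁ , x₂) (.x₁ , y₂) eq refl →
    cong (x₁ ,_) (*-cancelʳ p₄≢0 x₂ y₂ (+-cancelˡ (x₁ * p₂) _ _ (cong proj₂ eq))) }

  mat-≡ : ∀ {x y} → row₁ x ≡ row₁ y → row₂ x ≡ row₂ y → x ≡ y
  mat-≡ refl refl = refl

  +M-cancelʳ : ∀ z x y → x +M z ≡ y +M z → x ≡ y
  +M-cancelʳ (mat a b c d) (mat _ _ _ _) (mat _ _ _ _) eq
    with refl ← +-cancelʳ a _ _ (cong Mat.m11 eq) | refl ← +-cancelʳ b _ _ (cong Mat.m12 eq)
       | refl ← +-cancelʳ c _ _ (cong Mat.m21 eq) | refl ← +-cancelʳ d _ _ (cong Mat.m22 eq) = refl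

  +M-cancelˡ : ∀ z x y → z +M x ≡ z +M y → x ≡ y
  +M-cancelˡ (mat a b c d) (mat _ _ _ _) (mat _ _ _ _) eq
    with refl ← +-cancelˡ a _ _ (cong Mat.m11 eq) | refl ← +-cancelˡ b _ _ (cong Mat.m12 eq)
       | refl ← +-cancelˡ c _ _ (cong Mat.m21 eq) | refl ← +-cancelˡ d _ _ (cong Mat.m22 eq) = refl

  +M-solve : ∀ z v → ∃ λ x → x +M z ≡ v
  +M-solve (mat a b c d) (mat a′ b′ c′ d′) = mat (a′ + - a) (b′ + - b) (c′ + - c) (d′ + - d) ,
    mat-≡ (cong₂ _,_ (undo a a′) (undo b b′)) (cong₂ _,_ (undo c c′) (undo d d′))
    where
    undo : ∀ x y → (y + - x) + x ≡ y
    undo x y = trans (+-assoc y (- x) x) (trans (cong (y +_) (-‿inverseˡ x)) (+-identityʳ y))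

  ·-solve : ∀ x₂ t z → ∃ λ x₁ → (x₁ , x₂) · just t ≡ z
  ·-solve x₂ t z = z + - (x₂ * t) ,
    trans (+-assoc z _ _) (trans (cong (z +_) (-‿inverseˡ (x₂ * t))) (+-identityʳ z))

  ·-cancel : ∀ x₂ t {x₁ y₁} → (x₁ , x₂) · just t ≡ (y₁ , x₂) · just t → x₁ ≡ y₁
  ·-cancel x₂ t = +-cancelʳ (x₂ * t) _ _

  +M-difference : ∀ x y → ∃ λ P → x ≡ y +M P
  +M-difference (mat a b c d) (mat a′ b′ c′ d′)
    with p , refl ← difference a a′ | q , refl ← difference b b′
       | r , refl ← difference c c′ | s , refl ← difference d d′ = mat p q r s , refl

  +M-identityʳ : ∀ x → x +M 0ᴹ ≡ x
  +M-identityʳ (mat a b c d) =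
    mat-≡ (cong₂ _,_ (+-identityʳ a) (+-identityʳ b)) (cong₂ _,_ (+-identityʳ c) (+-identityʳ d))

  entry-difference : ∀ a b b′ x y d₁ d₂ p₁ p₂ → a + b ≡ x * (d₁ + p₁) + y * (d₂ + p₂) →
          a + b′ ≡ x * d₁ + y * d₂ → b ≡ b′ + (x * p₁ + y * p₂)
  entry-difference a b b′ x y d₁ d₂ p₁ p₂ e e′ = +-cancelˡ a _ _ (begin
    a + b                                    ≡⟨ e ⟩
    x * (d₁ + p₁) + y * (d₂ + p₂)
      ≡⟨ solve 6 (λ x y d₁ d₂ p₁ p₂ → x :* (d₁ :+ p₁) :+ y :* (d₂ :+ p₂) :=
            (x :* d₁ :+ y :* d₂) :+ (x :* p₁ :+ y :* p₂)) refl x y d₁ d₂ p₁ p₂ ⟩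
    (x * d₁ + y * d₂) + (x * p₁ + y * p₂)    ≡⟨ cong (_+ (x * p₁ + y * p₂)) e′ ⟨
    (a + b′) + (x * p₁ + y * p₂)             ≡⟨ +-assoc a b′ _ ⟩
    a + (b′ + (x * p₁ + y * p₂))             ∎)

  module _ (b b′ d′ P : Mat) where

    IsSolution : Mat × Mat → Set
    IsSolution (a , c) = a +M b ≡ c *M (d′ +M P) × a +M b′ ≡ c *M d′

    -- Subtracting the two equations eliminates `a` and `d′` and leaves b = b′ + c P, which is a
    -- separate condition on each row of `c`.
    solution-rows : ∀ {u} → IsSolution u →
      row₁ b ≡ row₁ b′ +ᵣ (row₁ (proj₂ u) *ᵣ P) × row₂ b ≡ row₂ b′ +ᵣ (row₂ (proj₂ u) *ᵣ P)
    solution-rows {a , c} (e , e′) =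
      cong₂ _,_
        (entry-difference a.m11 b.m11 b′.m11 c.m11 c.m12 d′.m11 d′.m21 P.m11 P.m21
          (cong Mat.m11 e) (cong Mat.m11 e′))
        (entry-difference a.m12 b.m12 b′.m12 c.m11 c.m12 d′.m12 d′.m22 P.m12 P.m22
          (cong Mat.m12 e) (cong Mat.m12 e′)) ,
      cong₂ _,_
        (entry-difference a.m21 b.m21 b′.m21 c.m21 c.m22 d′.m11 d′.m21 P.m11 P.m21
          (cong Mat.m21 e) (cong Mat.m21 e′))
        (entry-difference a.m22 b.m22 b′.m22 c.m21 c.m22 d′.m12 d′.m22 P.m12 P.m22
          (cong Mat.m22 e) (cong Mat.m22 e′))
      where
      module a = Mat a
      module b = Mat b
      module b′ = Mat b′
      module c = Mat c
      module d′ = Mat d′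
      module P = Mat P

    -- Apply b = b′ + c P to `w`: the term c P w vanishes.
    solution-fibre : ∀ {u w} → IsSolution u → Kills P w → row₁ b · w ≡ row₁ b′ · w × row₂ b · w ≡ row₂ b′ · w
    solution-fibre {a , c} {w} s kills =
      fixed (row₁ b′) (row₁ c) (proj₁ (solution-rows {a , c} s)) ,
      fixed (row₂ b′) (row₂ c) (proj₂ (solution-rows {a , c} s))
      where
      fixed : ∀ {x} y z → x ≡ y +ᵣ (z *ᵣ P) → x · w ≡ y · w
      fixed y z refl = trans (·-+ᵣ y (z *ᵣ P) w)
        (trans (cong (y · w +_) (Kills-*ᵣ z P w kills)) (+-identityʳ (y · w)))

    -- Two solutions have the same product c P, since it equals b - b′, and `c` determines `a`.
    -- Cancelling `P` is left as a hypothesis: it holds outright for nonsingular `P`, and for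
    -- nonzero `P` once one coordinate of each row is fixed.
    solutions-agree : ∀ {u v} → IsSolution u → IsSolution v →
      (row₁ (proj₂ u) *ᵣ P ≡ row₁ (proj₂ v) *ᵣ P → row₁ (proj₂ u) ≡ row₁ (proj₂ v)) →
      (row₂ (proj₂ u) *ᵣ P ≡ row₂ (proj₂ v) *ᵣ P → row₂ (proj₂ u) ≡ row₂ (proj₂ v)) → u ≡ v
    solutions-agree {a , c} {a′ , c′} s s′ cancel₁ cancel₂ =
      determined (mat-≡ (cancel₁ (agree (row₁ b′) (row₁ c) (row₁ c′) (proj₁ r) (proj₁ r′)))
                        (cancel₂ (agree (row₂ b′) (row₂ c) (row₂ c′) (proj₂ r) (proj₂ r′))))
      where
      r  = solution-rows {a , c} s
      r′ = solution-rows {a′ , c′} s′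
      agree : ∀ {x} y z z′ → x ≡ y +ᵣ (z *ᵣ P) → x ≡ y +ᵣ (z′ *ᵣ P) → z *ᵣ P ≡ z′ *ᵣ P
      agree y z z′ e e′ = +ᵣ-cancelˡ y (z *ᵣ P) (z′ *ᵣ P) (trans (sym e) e′)
      determined : c ≡ c′ → (a , c) ≡ (a′ , c′)
      determined refl = cong (_, c) (+M-cancelʳ b a a′ (trans (proj₁ s) (sym (proj₁ s′))))

  Kills⇒same : ∀ x P w → Kills P w → row₁ (x +M P) · w ≡ row₁ x · w × row₂ (x +M P) · w ≡ row₂ x · w
  Kills⇒same x P w (k₁ , k₂) = same (row₁ x) (row₁ P) k₁ , same (row₂ x) (row₂ P) k₂
    where
    same : ∀ y z → z · w ≡ 0# → (y +ᵣ z) · w ≡ y · w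
    same y z k = trans (·-+ᵣ y z w) (trans (cong (y · w +_) k) (+-identityʳ (y · w)))

  same⇒Kills : ∀ x P w → row₁ (x +M P) · w ≡ row₁ x · w → row₂ (x +M P) · w ≡ row₂ x · w → Kills P w
  same⇒Kills x P w p₁ p₂ = kill (row₁ x) (row₁ P) p₁ , kill (row₂ x) (row₂ P) p₂
    where
    kill : ∀ y z → (y +ᵣ z) · w ≡ y · w → z · w ≡ 0#
    kill y z p = +-cancelˡ (y · w) (z · w) 0# (trans (sym (·-+ᵣ y z w)) (trans p (sym (+-identityʳ (y · w)))))

-- Counting the solutions of a + b = c d.

module Counting {q : ℕ} (F : FiniteField q) where
  open import Data.Integer.Base using (ℤ; +_; _+_; _*_; -_; _-_; _≤_; 0ℤ; 1ℤ; nonNegative; Positive)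
  open FiniteSums
  open Nets
  open FiniteField F using (Carrier; enum; 0#; _≟_)
  open M2 F
  open LinearAlgebra F
  open +-*-Solver using (solve; _:=_; _:*_; _:^_; con)

  q̂ q² q⁴ : ℤ
  q̂ = + q
  q² = q̂ * q̂
  q⁴ = q² * q²

  instance
    q̂>0 : Positive q̂
    q̂>0 = inhabited⇒positive (Inverse.from enum 0#)
      where
      inhabited⇒positive : ∀ {n} → Fin n → Positive (+ n)
      inhabited⇒positive {suc n} _ = _


    q²>0 : Positive q²
    q²>0 = *-pos q̂ q̂

    q⁴>0 : Positive q⁴
    q⁴>0 = *-pos q² q²

  𝔽 : Enumeration Carrier
  𝔽 = record
    { elements = map (Inverse.to enum) (allFin q)
    ; unique   = Unique.map⁺ (λ {i} {j} eq → trans (sym (Inverse.strictlyInverseʳ enum i))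
                   (trans (cong (Inverse.from enum) eq) (Inverse.strictlyInverseʳ enum j))) (Unique.allFin⁺ q)
    ; complete = λ x → subst (_∈ _) (Inverse.strictlyInverseˡ enum x)
                   (∈-map⁺ (Inverse.to enum) (∈-allFin (Inverse.from enum x)))
    }

  ∣𝔽∣ : ∣ elements 𝔽 ∣ ≡ q̂
  ∣𝔽∣ = cong +_ (trans (length-map (Inverse.to enum) (allFin q)) (length-tabulate id))

  directions : Enumeration Direction
  directions = record
    { elements = nothing ∷ map just (elements 𝔽)
    ; unique   = All.map⁺ (All.universal (λ _ ()) (elements 𝔽)) ∷ Unique.map⁺ Maybe.just-injective (unique 𝔽)
    ; complete = λ { nothing → here refl ; (just t) → there (∈-map⁺ just (complete 𝔽 t)) }
    }

  ws : List Direction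
  ws = elements directions

  _≟ʷ_ : DecidableEquality Direction
  _≟ʷ_ = Maybe.≡-dec _≟_

  ∣ws∣ : ∣ ws ∣ ≡ 1ℤ + q̂
  ∣ws∣ = trans (cong (λ n → + suc n) (length-map just (elements 𝔽))) (+-congʳ 1ℤ ∣𝔽∣)

  row-net : Net Direction Row Carrier q̂
  row-net = record
    { points      = enumeration-× 𝔽 𝔽 _,_ proj₁ proj₂ (λ _ _ → refl) (λ _ _ → refl) (λ _ → refl)
    ; _≟ᵛ_        = ≡-dec _≟_ _≟_
    ; _≟ᶻ_        = _≟_
    ; π           = λ w x → x · w
    ; ∣points∣    = trans (∣cartesianProductWith∣ _,_ fs fs) (cong₂ _*_ ∣𝔽∣ ∣𝔽∣)
    ; fibre       = λ w x → trans (∑-cartesianProductWith _,_ fs fs (λ u → ⟦ (u · w) ≟ (x · w) ⟧))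
                              (line w (x · w))
    ; transversal = ·-transversal
    }
    where
    fs = elements 𝔽
    ∑-1 : (∑[ x ∈ fs ] 1ℤ) ≡ q̂
    ∑-1 = trans (∑-const fs 1ℤ) (trans (ℤ.*-identityʳ _) ∣𝔽∣)
    line : ∀ w z → (∑[ a ∈ fs ] ∑[ b ∈ fs ] ⟦ ((a , b) · w) ≟ z ⟧) ≡ q̂
    -- In the direction `nothing` the first coordinate is free and the second is fixed; in a
    -- direction `just t` the second is free and determines the first.
    line nothing  z = trans (∑-cong fs λ a → count≡1 (_≟ z) 𝔽 z refl (λ p q → trans p (sym q))) ∑-1
    line (just t) z = trans (∑-swap fs fs (λ a b → ⟦ ((a , b) · just t) ≟ z ⟧))
      (trans (∑-cong fs λ b → count≡1 (λ a → ((a , b) · just t) ≟ z) 𝔽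
                (proj₁ (·-solve b t z)) (proj₂ (·-solve b t z))
                (λ p q → ·-cancel b t (trans p (sym q)))) ∑-1)

  -- The lines are the fibres of M ↦ M w: two matrices are collinear in the class `w` when their
  -- difference kills `w`.
  mat-net : Net Direction Mat (Carrier × Carrier) q²
  mat-net = net-× row-net row-net _≟M_ fromRows row₁ row₂ (λ _ _ → refl) (λ _ _ → refl) (λ _ → refl)

  _≟ᴾ_ : DecidableEquality (Mat × Mat)
  _≟ᴾ_ = ≡-dec _≟M_ _≟M_

  pair-net : Net Direction (Mat × Mat) ((Carrier × Carrier) × (Carrier × Carrier)) q⁴
  pair-net = net-× mat-net mat-net _≟ᴾ_ _,_ proj₁ proj₂ (λ _ _ → refl) (λ _ _ → refl) (λ _ → refl)

  module Rows = Net row-net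
  module Mats = Net mat-net
  module Pairs = Net pair-net

  ms : List Mat
  ms = elements Mats.points

  -- The points of `pair-net` are reused here as the range of the pairs (a, c).
  us : List (Mat × Mat)
  us = elements Pairs.points

  solves? : ∀ u x → Dec (proj₁ u +M proj₁ x ≡ proj₂ u *M proj₂ x)
  solves? u x = (proj₁ u +M proj₁ x) ≟M (proj₂ u *M proj₂ x)

  -- Each `c` admits exactly one `a`, namely c d - b.
  ∑-solves : ∀ x → (∑[ u ∈ us ] ⟦ solves? u x ⟧) ≡ q⁴
  ∑-solves x@(b , d) = begin
    (∑[ u ∈ us ] ⟦ solves? u x ⟧)
      ≡⟨ ∑-cartesianProductWith _,_ ms ms (λ u → ⟦ solves? u x ⟧) ⟩
    (∑[ a ∈ ms ] ∑[ c ∈ ms ] ⟦ solves? (a , c) x ⟧)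
      ≡⟨ ∑-swap ms ms (λ a c → ⟦ solves? (a , c) x ⟧) ⟩
    (∑[ c ∈ ms ] ∑[ a ∈ ms ] ⟦ solves? (a , c) x ⟧)    ≡⟨ ∑-cong ms unique-a ⟩
    (∑[ c ∈ ms ] 1ℤ)                                   ≡⟨ ∑-const ms 1ℤ ⟩
    ∣ ms ∣ * 1ℤ                                        ≡⟨ ℤ.*-identityʳ _ ⟩
    ∣ ms ∣                                             ≡⟨ Mats.∣points∣ ⟩
    q⁴                                                 ∎
    where
    open ≡-Reasoning
    unique-a : ∀ c → (∑[ a ∈ ms ] ⟦ solves? (a , c) x ⟧) ≡ 1ℤ
    unique-a c = count≡1 (λ a → solves? (a , c) x) Mats.points
      (proj₁ (+M-solve b (c *M d))) (proj₂ (+M-solve b (c *M d)))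
      (λ {a} {a′} p q → +M-cancelʳ b a a′ (trans p (sym q)))

  -- The Gram matrix of the indicator functions of the solution sets; its sum over pairs from a list
  -- is the second moment of the number of solutions.
  gram : Mat × Mat → Mat × Mat → ℤ
  gram x y = ∑[ u ∈ us ] ⟦ solves? u x ⟧ * ⟦ solves? u y ⟧

  both? : ∀ x y u → Dec _
  both? x y u = solves? u x ×-dec solves? u y

  gram-count : ∀ x y → gram x y ≡ (∑[ u ∈ us ] ⟦ both? x y u ⟧)
  gram-count x y = ∑-cong us λ u → ⟦⟧-× (solves? u x) (solves? u y)

  -- The second function counts the directions killed by the difference of the second components: 0
  -- if it is invertible, 1 if it has rank one, 1 + q if it is zero.
  ∑same ∑same₂ : Mat × Mat → Mat × Mat → ℤ
  ∑same  x y = ∑[ w ∈ ws ] Pairs.same w x y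
  ∑same₂ x y = ∑[ w ∈ ws ] Mats.same w (proj₂ x) (proj₂ y)

  ∑same-nonneg : ∀ x y → 0ℤ ≤ ∑same x y
  ∑same-nonneg x y = ∑-nonneg ws λ w → ⟦⟧-nonneg (Pairs.π w x Pairs.≟ᶻ Pairs.π w y)

  -- With a common `d`, a + b = c d = a + b′ forces b = b′; a single pair (b, d) has q⁴ solutions by
  -- `∑-solves`.
  gram-diagonal : ∀ b b′ d → gram (b , d) (b′ , d) ≤ q⁴ * ⟦ (b , d) ≟ᴾ (b′ , d) ⟧
  gram-diagonal b b′ d with (b , d) ≟ᴾ (b′ , d)
  ... | yes _ = begin
    gram (b , d) (b′ , d)                  ≤⟨ ∑-mono us (λ u → below (solves? u (b , d)) (solves? u (b′ , d))) ⟩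
    (∑[ u ∈ us ] ⟦ solves? u (b , d) ⟧)    ≡⟨ ∑-solves (b , d) ⟩
    q⁴                                     ≡⟨ ℤ.*-identityʳ q⁴ ⟨
    q⁴ * 1ℤ                                ∎
    where
    open ℤ.≤-Reasoning
    below : ∀ {A B : Set} (a? : Dec A) (b? : Dec B) → ⟦ a? ⟧ * ⟦ b? ⟧ ≤ ⟦ a? ⟧
    below (yes _) b? = ℤ.≤-trans (ℤ.≤-reflexive (ℤ.*-identityˡ ⟦ b? ⟧)) (⟦⟧-≤1 b?)
    below (no  _) b? = ℤ.≤-refl
  ... | no x≢y = ℤ.≤-reflexive (trans (gram-count (b , d) (b′ , d)) (trans
    (count-none (both? (b , d) (b′ , d)) us λ (a , c) (p , q) →
      x≢y (cong (_, d) (+M-cancelˡ a b b′ (trans p (sym q))))) (sym (ℤ.*-zeroʳ q⁴))))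

  ∑same₂≤∣ws∣ : ∀ x y → ∑same₂ x y ≤ 1ℤ + q̂
  ∑same₂≤∣ws∣ x y = begin
    ∑same₂ x y          ≤⟨ ∑-mono ws (λ w → ⟦⟧-≤1 (Mats.π w (proj₂ x) Mats.≟ᶻ Mats.π w (proj₂ y))) ⟩
    (∑[ w ∈ ws ] 1ℤ)    ≡⟨ ∑-const ws 1ℤ ⟩
    ∣ ws ∣ * 1ℤ         ≡⟨ ℤ.*-identityʳ _ ⟩
    ∣ ws ∣              ≡⟨ ∣ws∣ ⟩
    1ℤ + q̂              ∎
    where open ℤ.≤-Reasoning

  -- Matrices that agree in two different directions are equal.
  ∑same₂≤1 : ∀ x y → proj₂ x ≢ proj₂ y → ∑same₂ x y ≤ 1ℤ
  ∑same₂≤1 x y d≢d′ = count≤1 (λ w → Mats.π w (proj₂ x) Mats.≟ᶻ Mats.π w (proj₂ y)) (unique directions) coincide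
    where
    coincide : ∀ {w w′} → Mats.π w (proj₂ x) ≡ Mats.π w (proj₂ y) →
               Mats.π w′ (proj₂ x) ≡ Mats.π w′ (proj₂ y) → w ≡ w′
    coincide {w} {w′} p q with w ≟ʷ w′
    ... | yes w≡w′ = w≡w′
    ... | no  w≢w′ = contradiction (Mats.transversal w≢w′ p q) d≢d′

  -- If b w ≠ b′ w there is no solution. Otherwise one coordinate of each row of `c` determines the
  -- solution, which leaves at most q² of them, and `w` itself contributes 1 to `∑same`.
  gram-singular : ∀ b b′ d′ P w → P ≢ 0ᴹ → Kills P w →
    gram (b , d′ +M P) (b′ , d′) ≤ q² * ∑same (b , d′ +M P) (b′ , d′)
  gram-singular b b′ d′ P w P≢0 kills with Mats.π w b Mats.≟ᶻ Mats.π w b′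
  ... | no b≢b′ = begin
    gram x y                              ≡⟨ gram-count x y ⟩
    (∑[ u ∈ us ] ⟦ both? x y u ⟧)         ≡⟨ count-none (both? x y) us (λ u s → b≢b′ (transfer u s)) ⟩
    0ℤ                                    ≤⟨ 0≤-* (0≤i*i q̂) (∑same-nonneg x y) ⟩
    q² * ∑same x y                        ∎
    where
    open ℤ.≤-Reasoning
    x = b , d′ +M P
    y = b′ , d′
    transfer : ∀ u → IsSolution b b′ d′ P u → Mats.π w b ≡ Mats.π w b′
    transfer u s = let r = solution-fibre b b′ d′ P {u} {w} s kills in cong₂ _,_ (proj₁ r) (proj₂ r)
  ... | yes b≡b′ = begin
    gram x y                              ≡⟨ gram-count x y ⟩
    (∑[ u ∈ us ] ⟦ both? x y u ⟧)
      ≤⟨ count≤codomain (both? x y) (unique Pairs.points) Rows._≟ᵛ_ Rows.points φ φ-injective ⟩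
    ∣ elements Rows.points ∣                 ≡⟨ Rows.∣points∣ ⟩
    q²                                    ≡⟨ ℤ.*-identityʳ q² ⟨
    q² * 1ℤ
      ≤⟨ *-monoˡ-≤ q² (0≤i*i q̂)
           (1≤count (λ w → Pairs.π w x Pairs.≟ᶻ Pairs.π w y) (complete directions w) same) ⟩
    q² * ∑same x y                        ∎
    where
    open ℤ.≤-Reasoning
    x = b , d′ +M P
    y = b′ , d′
    coordinate = nonzero⇒coordinate P P≢0
    φ : Mat × Mat → Row
    φ (a , c) = proj₁ coordinate (row₁ c) , proj₁ coordinate (row₂ c)
    φ-injective : ∀ {u v} → IsSolution b b′ d′ P u → IsSolution b b′ d′ P v → φ u ≡ φ v → u ≡ v
    φ-injective {a , c} {a′ , c′} s s′ eq = solutions-agree b b′ d′ P {a , c} {a′ , c′} s s′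
      (λ e → proj₂ coordinate (row₁ c) (row₁ c′) e (cong proj₁ eq))
      (λ e → proj₂ coordinate (row₂ c) (row₂ c′) e (cong proj₂ eq))
    same : Pairs.π w x ≡ Pairs.π w y
    same = let r = Kills⇒same d′ P w kills in cong₂ _,_ b≡b′ (cong₂ _,_ (proj₁ r) (proj₂ r))

  gram-nonsingular : ∀ b b′ d′ P → (∀ w → ¬ Kills P w) → gram (b , d′ +M P) (b′ , d′) ≤ 1ℤ
  gram-nonsingular b b′ d′ P ¬kills = ℤ.≤-trans (ℤ.≤-reflexive (gram-count (b , d′ +M P) (b′ , d′)))
    (count≤1 (both? (b , d′ +M P) (b′ , d′)) (unique Pairs.points) λ {u} {v} s s′ →
      solutions-agree b b′ d′ P {u} {v} s s′ (nonsingular⇒injective P ¬kills (row₁ (proj₂ u)) (row₁ (proj₂ v)))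
                                             (nonsingular⇒injective P ¬kills (row₂ (proj₂ u)) (row₂ (proj₂ v))))

  ∑same₂-nonsingular : ∀ b b′ d′ P → (∀ w → ¬ Kills P w) → ∑same₂ (b , d′ +M P) (b′ , d′) ≡ 0ℤ
  ∑same₂-nonsingular b b′ d′ P ¬kills =
    count-none (λ w → Mats.π w (d′ +M P) Mats.≟ᶻ Mats.π w d′) ws
      λ w eq → ¬kills w (same⇒Kills d′ P w (cong proj₁ eq) (cong proj₂ eq))

  -- The constant 1 pays for the one solution of the invertible case. For a singular difference it
  -- is spare and pays for `∑same₂`, together with the term `q̂` when the second components
  -- coincide. Keeping `∑same₂` on the left is what later cancels the main term of the collinear
  -- pairs.
  gram-bound : ∀ x y → gram x y + ∑same₂ x y ≤
    1ℤ + q² * ∑same x y + (q⁴ * ⟦ x ≟ᴾ y ⟧ + q̂ * ⟦ proj₂ x ≟M proj₂ y ⟧)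
  gram-bound x@(b , d) y@(b′ , d′) with d ≟M d′
  ... | yes refl = ≤-from-difference
        (ℤ.+-mono-≤ (ℤ.+-mono-≤ (gram-diagonal b b′ d) (∑same₂≤∣ws∣ x y)) (0≤-* (0≤i*i q̂) (∑same-nonneg x y)))
        (eq (gram x y) (∑same₂ x y) (q² * ∑same x y) (q⁴ * ⟦ x ≟ᴾ y ⟧) q̂)
    where
    eq : ∀ g s t r q → r + (1ℤ + q) + t + - (g + s + 0ℤ) ≡ 1ℤ + t + (r + q * 1ℤ) + - (g + s)
    eq = solve-∀
  ... | no d≢d′ with P , refl ← +M-difference d d′ = ℤ.≤-trans off-diagonal
        (subst (1ℤ + q² * ∑same x y ≤_)
          (+-congʳ (1ℤ + q² * ∑same x y) (+-congʳ (q⁴ * ⟦ x ≟ᴾ y ⟧) (sym (ℤ.*-zeroʳ q̂))))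
          (ℤ.i≤i+j (1ℤ + q² * ∑same x y) (q⁴ * ⟦ x ≟ᴾ y ⟧ + 0ℤ)
            {{nonNegative (0≤-+ (0≤-* (0≤i*i q²) (⟦⟧-nonneg (x ≟ᴾ y))) ℤ.≤-refl)}}))
    where
    open ℤ.≤-Reasoning
    off-diagonal : gram x y + ∑same₂ x y ≤ 1ℤ + q² * ∑same x y
    -- Singularity is decided by searching the finitely many directions for a killed one.
    off-diagonal with any? (kills? P) ws
    ... | yes singular with w , _ , kills ← find singular = begin
      gram x y + ∑same₂ x y    ≤⟨ ℤ.+-mono-≤ (gram-singular b b′ d′ P w P≢0 kills) (∑same₂≤1 x y d≢d′) ⟩
      q² * ∑same x y + 1ℤ      ≡⟨ ℤ.+-comm (q² * ∑same x y) 1ℤ ⟩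
      1ℤ + q² * ∑same x y      ∎
      where
      P≢0 : P ≢ 0ᴹ
      P≢0 refl = d≢d′ (+M-identityʳ d′)
    ... | no ¬singular = ℤ.+-mono-≤ (gram-nonsingular b b′ d′ P ¬kills)
      (ℤ.≤-trans (ℤ.≤-reflexive (∑same₂-nonsingular b b′ d′ P ¬kills)) (0≤-* (0≤i*i q̂) (∑same-nonneg x y)))
      where
      ¬kills : ∀ w → ¬ Kills P w
      ¬kills w kills = ¬singular (lose (complete directions w) kills)

  -- The second moment of the number of solutions and the incidence bound.

  solutions : List (Mat × Mat) → Mat × Mat → ℤ
  solutions xs u = ∑[ x ∈ xs ] ⟦ solves? u x ⟧

  ∑-solutions : ∀ xs → ∑ us (solutions xs) ≡ ∣ xs ∣ * q⁴
  ∑-solutions xs = trans (∑-swap us xs (λ u x → ⟦ solves? u x ⟧)) (trans (∑-cong xs ∑-solves) (∑-const xs q⁴))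

  module _ {xs : List (Mat × Mat)} (uniq : Unique xs) where
    private
      n = ∣ xs ∣
      ds = map proj₂ xs
      S  = ∑[ w ∈ ws ] Pairs.pairs xs w
      S₂ = ∑[ w ∈ ws ] Mats.pairs ds w
      N² = ∑[ u ∈ us ] solutions xs u * solutions xs u

    ∑∑ : (Mat × Mat → Mat × Mat → ℤ) → ℤ
    ∑∑ f = ∑[ x ∈ xs ] ∑[ y ∈ xs ] f x y

    private
      ∑∑-+ : ∀ f g → ∑∑ (λ x y → f x y + g x y) ≡ ∑∑ f + ∑∑ g
      ∑∑-+ f g = trans (∑-cong xs λ x → ∑-+ xs (f x) (g x)) (∑-+ xs (λ x → ∑ xs (f x)) (λ x → ∑ xs (g x)))

      ∑∑-* : ∀ c f → ∑∑ (λ x y → c * f x y) ≡ c * ∑∑ f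
      ∑∑-* c f = trans (∑-cong xs λ x → ∑-*ˡ xs c (f x)) (∑-*ˡ xs c (λ x → ∑ xs (f x)))

      ∑∑-mono : ∀ {f g} → (∀ x y → f x y ≤ g x y) → ∑∑ f ≤ ∑∑ g
      ∑∑-mono f≤g = ∑-mono xs λ x → ∑-mono xs (f≤g x)

      ∑∑-∑ : ∀ (f : Direction → Mat × Mat → Mat × Mat → ℤ) →
        ∑∑ (λ x y → ∑[ w ∈ ws ] f w x y) ≡ (∑[ w ∈ ws ] ∑∑ (f w))
      ∑∑-∑ f = trans (∑-cong xs λ x → ∑-swap xs ws (λ y w → f w x y)) (∑-swap xs ws (λ x w → ∑ xs (f w x)))

      ∑∑≤ : ∀ c f → (∀ x → ∑ xs (f x) ≤ c) → ∑∑ f ≤ n * c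
      ∑∑≤ c f le = ℤ.≤-trans (∑-mono xs le) (ℤ.≤-reflexive (∑-const xs c))

      ∑∑-1 : ∑∑ (λ _ _ → 1ℤ) ≡ n * n
      ∑∑-1 = trans (∑-cong xs λ _ → trans (∑-const xs 1ℤ) (ℤ.*-identityʳ n)) (∑-const xs n)

      ∑∑same₂ : ∑∑ ∑same₂ ≡ S₂
      ∑∑same₂ = trans (∑∑-∑ λ w x y → Mats.same w (proj₂ x) (proj₂ y)) (∑-cong ws λ w → sym
        (trans (∑-map proj₂ xs _) (∑-cong xs λ x → ∑-map proj₂ xs (Mats.same w (proj₂ x)))))

      ∑∑-diagonal : ∑∑ (λ x y → ⟦ x ≟ᴾ y ⟧) ≤ n * 1ℤ
      ∑∑-diagonal = ∑∑≤ 1ℤ _ λ x → count≤1 (x ≟ᴾ_) uniq λ p q → trans (sym p) q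

      -- For fixed `x`, a pair `y` with the same second component is determined by its first, one of
      -- q⁴ matrices.
      ∑∑-diagonal₂ : ∑∑ (λ x y → ⟦ proj₂ x ≟M proj₂ y ⟧) ≤ n * q⁴
      ∑∑-diagonal₂ = ∑∑≤ q⁴ _ λ x → ℤ.≤-trans
        (count≤codomain (λ y → proj₂ x ≟M proj₂ y) uniq _≟M_ Mats.points proj₁
          (λ { {_ , _} {_ , _} refl refl refl → refl }))
        (ℤ.≤-reflexive Mats.∣points∣)

      gram-sum : N² + S₂ ≤ n * n + q² * S + (q⁴ * (n * 1ℤ) + q̂ * (n * q⁴))
      gram-sum = begin
        N² + S₂
          ≡⟨ cong₂ _+_ (∑-bilinear us xs xs (λ u x → ⟦ solves? u x ⟧) (λ u x → ⟦ solves? u x ⟧)) (sym ∑∑same₂) ⟩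
        ∑∑ gram + ∑∑ ∑same₂
          ≡⟨ ∑∑-+ gram ∑same₂ ⟨
        ∑∑ (λ x y → gram x y + ∑same₂ x y)
          ≤⟨ ∑∑-mono gram-bound ⟩
        ∑∑ (λ x y → 1ℤ + q² * ∑same x y + (q⁴ * ⟦ x ≟ᴾ y ⟧ + q̂ * ⟦ proj₂ x ≟M proj₂ y ⟧))
          ≡⟨ trans (∑∑-+ (λ x y → 1ℤ + q² * ∑same x y) (λ x y → q⁴ * ⟦ x ≟ᴾ y ⟧ + q̂ * ⟦ proj₂ x ≟M proj₂ y ⟧))
               (cong₂ _+_
                 (trans (∑∑-+ (λ _ _ → 1ℤ) (λ x y → q² * ∑same x y))
                   (cong₂ _+_ ∑∑-1 (trans (∑∑-* q² ∑same) (cong (q² *_) (∑∑-∑ Pairs.same)))))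
                 (trans (∑∑-+ (λ x y → q⁴ * ⟦ x ≟ᴾ y ⟧) (λ x y → q̂ * ⟦ proj₂ x ≟M proj₂ y ⟧))
                   (cong₂ _+_ (∑∑-* q⁴ (λ x y → ⟦ x ≟ᴾ y ⟧)) (∑∑-* q̂ (λ x y → ⟦ proj₂ x ≟M proj₂ y ⟧))))) ⟩
        n * n + q² * S + (q⁴ * ∑∑ (λ x y → ⟦ x ≟ᴾ y ⟧) + q̂ * ∑∑ (λ x y → ⟦ proj₂ x ≟M proj₂ y ⟧))
          ≤⟨ ℤ.+-monoʳ-≤ (n * n + q² * S)
               (ℤ.+-mono-≤ (*-monoˡ-≤ q⁴ (0≤i*i q²) ∑∑-diagonal) (*-monoˡ-≤ q̂ 0≤+ ∑∑-diagonal₂)) ⟩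
        n * n + q² * S + (q⁴ * (n * 1ℤ) + q̂ * (n * q⁴)) ∎
        where open ℤ.≤-Reasoning

      -- `pairs-lower` is applied in each direction to the second components, listed with
      -- multiplicity so that their number is still `n`.
      S₂-lower : ∣ ws ∣ * (n * n) ≤ q² * S₂
      S₂-lower = begin
        ∣ ws ∣ * (n * n)                     ≡⟨ ∑-const ws (n * n) ⟨
        (∑[ w ∈ ws ] n * n)                  ≤⟨ ∑-mono ws (λ w → subst (λ l → + l * + l ≤ q² * Mats.pairs ds w)
                                                  (length-map proj₂ xs) (SecondMoment.pairs-lower mat-net ds w)) ⟩
        (∑[ w ∈ ws ] q² * Mats.pairs ds w)      ≡⟨ ∑-*ˡ ws q² (Mats.pairs ds) ⟩
        q² * S₂                              ∎
        where open ℤ.≤-Reasoning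

      S-upper : q⁴ * S ≤ ∣ ws ∣ * (n * n) + q⁴ * q⁴ * n
      S-upper = SecondMoment.pairs-upper pair-net directions _≟ʷ_ uniq

    -- The terms ∣ ws ∣ * (n * n) of S₂-lower and S-upper cancel.
    solutions-second-moment : (∑[ u ∈ us ] solutions xs u * solutions xs u) ≤ n * n + + 3 * (q² * q⁴ * n)
    solutions-second-moment = ℤ.*-cancelˡ-≤-pos _ _ q²
      -- The combination is q² times `gram-sum` plus `S₂-lower` plus `S-upper`. After division by q²
      -- the errors are q⁴n, q⁵n and q⁶n, each at most q⁶n; hence the constant 3.
      (≤-from-difference
        (ℤ.+-mono-≤ (ℤ.+-mono-≤ (*-monoˡ-≤ q² (0≤i*i q̂) gram-sum) (ℤ.+-mono-≤ S₂-lower S-upper))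
          (*-monoˡ-≤ q² (0≤i*i q̂) (ℤ.+-mono-≤ (*-monoʳ-≤ (q⁴ * n) 0≤q⁴n 1≤q²) (*-monoʳ-≤ (q⁴ * n) 0≤q⁴n q̂≤q²))))
        (eq N² S₂ S n ∣ ws ∣ q̂))
      where
      0≤q⁴n : 0ℤ ≤ q⁴ * n
      0≤q⁴n = 0≤-* (0≤i*i q²) 0≤+
      1≤q̂ : 1ℤ ≤ q̂
      1≤q̂ = ℤ.i<j⇒suc[i]≤j (ℤ.positive⁻¹ q̂)
      q̂≤q² : q̂ ≤ q²
      q̂≤q² = ℤ.≤-trans (ℤ.≤-reflexive (sym (ℤ.*-identityʳ q̂))) (*-monoˡ-≤ q̂ 0≤+ 1≤q̂)
      1≤q² : 1ℤ ≤ q²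
      1≤q² = ℤ.≤-trans 1≤q̂ q̂≤q²
      eq : ∀ N S₂ S n k q → let q² = q * q; q⁴ = q² * q² in
        q² * (n * n + q² * S + (q⁴ * (n * 1ℤ) + q * (n * q⁴))) + (q² * S₂ + (k * (n * n) + q⁴ * q⁴ * n))
          + q² * (q² * (q⁴ * n) + q² * (q⁴ * n))
        + - (q² * (N + S₂) + (k * (n * n) + q⁴ * S) + q² * (1ℤ * (q⁴ * n) + q * (q⁴ * n)))
        ≡ q² * (n * n + + 3 * (q² * q⁴ * n)) + - (q² * N)
      eq = solve-∀

    -- `Δ` is the deviation from the expected count, multiplied by q⁴ to clear the denominator. In
    -- `deviation` the universe has q⁸ elements and the total is q⁴n, so the term `n * n` of the
    -- second moment cancels against the squared mean.
    incidence-bound : ∀ {ys} → Unique ys → let Δ = q⁴ * ∑ ys (solutions xs) - ∣ ys ∣ * n in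
      Δ * Δ ≤ + 3 * (q² * q⁴ * (∣ ys ∣ * n)) * (q⁴ * q⁴)
    incidence-bound {ys} uniq-ys = ℤ.*-cancelˡ-≤-pos _ _ (q⁴ * q⁴) {{*-pos q⁴ q⁴}} (begin
      q⁴ * q⁴ * (Δ * Δ)
        ≡⟨ trans (eq₁ q⁴ J m n) (sym (cong₂ _*_ D≡ D≡)) ⟩
      D * D
        ≤⟨ deviation _≟ᴾ_ Pairs.points uniq-ys (solutions xs) ⟩
      m * (∣ us ∣ * (∣ us ∣ * N² - T * T))
        ≡⟨ trans (cong₂ (λ u t → m * (u * (u * N² - t * t))) Pairs.∣points∣ (∑-solutions xs)) (eq₂ q⁴ N² m n) ⟩
      m * (q⁴ * q⁴) * (q⁴ * q⁴) * (N² - n * n)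
        ≤⟨ *-monoˡ-≤ (m * (q⁴ * q⁴) * (q⁴ * q⁴)) (0≤-* (0≤-* {m} 0≤+ (0≤i*i q⁴)) (0≤i*i q⁴))
             (ℤ.≤-trans (ℤ.+-monoˡ-≤ (- (n * n)) solutions-second-moment)
               (ℤ.≤-reflexive (eq₃ (n * n) (+ 3 * (q² * q⁴ * n))))) ⟩
      m * (q⁴ * q⁴) * (q⁴ * q⁴) * (+ 3 * (q² * q⁴ * n))
        ≡⟨ eq₄ q² q⁴ m n ⟩
      q⁴ * q⁴ * (+ 3 * (q² * q⁴ * (m * n)) * (q⁴ * q⁴)) ∎)
      where
      open ℤ.≤-Reasoning
      m = ∣ ys ∣
      J = ∑ ys (solutions xs)
      T = ∑ us (solutions xs)
      Δ = q⁴ * J - m * n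
      D = ∣ us ∣ * J - m * T
      D≡ : D ≡ q⁴ * q⁴ * J - m * (n * q⁴)
      D≡ = cong₂ (λ u t → u * J - m * t) Pairs.∣points∣ (∑-solutions xs)
      eq₁ : ∀ q J m n → q * q * ((q * J + - (m * n)) * (q * J + - (m * n))) ≡
                        (q * q * J + - (m * (n * q))) * (q * q * J + - (m * (n * q)))
      eq₁ = solve-∀
      eq₂ : ∀ q N m n → m * (q * q * (q * q * N + - (n * q * (n * q)))) ≡ m * (q * q) * (q * q) * (N + - (n * n))
      eq₂ = solve-∀
      eq₃ : ∀ i j → i + j + - i ≡ j
      eq₃ = solve-∀
      eq₄ : ∀ p q m n → m * (q * q) * (q * q) * (+ 3 * (p * q * n)) ≡ q * q * (+ 3 * (p * q * (m * n)) * (q * q))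
      eq₄ = solve-∀

    -- If q⁴J exceeds twice the main term, then it is at most 2Δ, and squaring gives the second
    -- alternative with 12 = 4 · 3.
    incidence-dichotomy : ∀ {ys} → Unique ys → let J = ∑ ys (solutions xs) in
      (q⁴ * J ≤ + 2 * (∣ ys ∣ * n)) ⊎ (J * J ≤ + 12 * (q² * q⁴ * (∣ ys ∣ * n)))
    incidence-dichotomy {ys} uniq-ys with q⁴ * ∑ ys (solutions xs) ℤ.≤? + 2 * (∣ ys ∣ * n)
    ... | yes small = inj₁ small
    ... | no  large = inj₂ (ℤ.*-cancelˡ-≤-pos _ _ (q⁴ * q⁴) {{*-pos q⁴ q⁴}} (begin
      q⁴ * q⁴ * (J * J)                                    ≡⟨ eq₁ q⁴ J ⟩
      q⁴ * J * (q⁴ * J)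
        ≤⟨ ℤ.≤-trans (*-monoˡ-≤ (q⁴ * J) 0≤q⁴J q⁴J≤2Δ)
             (*-monoʳ-≤ (+ 2 * Δ) (ℤ.≤-trans 0≤q⁴J q⁴J≤2Δ) q⁴J≤2Δ) ⟩
      + 2 * Δ * (+ 2 * Δ)                                  ≡⟨ eq₂ Δ ⟩
      + 4 * (Δ * Δ)                                        ≤⟨ *-monoˡ-≤ (+ 4) 0≤+ (incidence-bound uniq-ys) ⟩
      + 4 * (+ 3 * (q² * q⁴ * (m * n)) * (q⁴ * q⁴))        ≡⟨ eq₃ (q² * q⁴ * (m * n)) (q⁴ * q⁴) ⟩
      q⁴ * q⁴ * (+ 12 * (q² * q⁴ * (m * n)))               ∎))
      where
      open ℤ.≤-Reasoning
      m = ∣ ys ∣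
      J = ∑ ys (solutions xs)
      Δ = q⁴ * J - m * n
      0≤q⁴J : 0ℤ ≤ q⁴ * J
      0≤q⁴J = 0≤-* (0≤i*i q²) (∑-nonneg ys λ u → ∑-nonneg xs λ x → ⟦⟧-nonneg (solves? u x))
      q⁴J≤2Δ : q⁴ * J ≤ + 2 * Δ
      q⁴J≤2Δ = ≤-from-difference (ℤ.<⇒≤ (ℤ.≰⇒> large)) (eq (q⁴ * J) (m * n))
        where
        eq : ∀ i j → i + - (+ 2 * j) ≡ + 2 * (i + - j) + - i
        eq = solve-∀
      eq₁ : ∀ i j → i * i * (j * j) ≡ i * j * (i * j)
      eq₁ = solve-∀
      eq₂ : ∀ i → + 2 * i * (+ 2 * i) ≡ + 4 * (i * i)
      eq₂ = solve-∀
      eq₃ : ∀ i j → + 4 * (+ 3 * i * j) ≡ j * (+ 12 * i)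
      eq₃ = solve-∀

  energy-solutions : ∀ A B C D →
    + energy A B C D ≡ ∑ (cartesianProduct A C) (solutions (cartesianProduct B D))
  energy-solutions A B C D = begin
    + energy A B C D
      ≡⟨ trans (+-sum _ A) (∑-cong A λ a → trans (+-sum _ B) (∑-cong B λ b →
           trans (+-sum _ C) (∑-cong C λ c → +-length-filter (λ d → (a +M b) ≟M (c *M d)) D))) ⟩
    (∑[ a ∈ A ] ∑[ b ∈ B ] ∑[ c ∈ C ] ∑[ d ∈ D ] ⟦ solves? (a , c) (b , d) ⟧)
      ≡⟨ ∑-cong A (λ a → ∑-swap B C (λ b c → ∑[ d ∈ D ] ⟦ solves? (a , c) (b , d) ⟧)) ⟩
    (∑[ a ∈ A ] ∑[ c ∈ C ] ∑[ b ∈ B ] ∑[ d ∈ D ] ⟦ solves? (a , c) (b , d) ⟧)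
      ≡⟨ ∑-cong A (λ a → ∑-cong C λ c → ∑-cartesianProductWith _,_ B D (λ x → ⟦ solves? (a , c) x ⟧)) ⟨
    (∑[ a ∈ A ] ∑[ c ∈ C ] solutions (cartesianProduct B D) (a , c))
      ≡⟨ ∑-cartesianProductWith _,_ A C (solutions (cartesianProduct B D)) ⟨
    ∑ (cartesianProduct A C) (solutions (cartesianProduct B D)) ∎
    where open ≡-Reasoning

  energy-dichotomy : ∀ {A B C D} → Unique A → Unique B → Unique C → Unique D →
    let α = length A; β = length B; γ = length C; δ = length D; J = energy A B C D in
    (q ^ 4 ℕ.* J ℕ.≤ 2 ℕ.* (α ℕ.* β ℕ.* γ ℕ.* δ)) ⊎ (J ^ 2 ℕ.≤ 12 ℕ.* (q ^ 6 ℕ.* (α ℕ.* β ℕ.* γ ℕ.* δ)))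
  energy-dichotomy {A} {B} {C} {D} uA uB uC uD =
    to-ℕ (subst₂ (λ j s → (q⁴ * j ≤ + 2 * s) ⊎ (j * j ≤ + 12 * (q² * q⁴ * s)))
      (sym (energy-solutions A B C D))
      (cong₂ _*_ (∣cartesianProductWith∣ _,_ A C) (∣cartesianProductWith∣ _,_ B D))
      (incidence-dichotomy (Unique.cartesianProduct⁺ uB uD) (Unique.cartesianProduct⁺ uA uC)))
    where
    α = length A; β = length B; γ = length C; δ = length D; J = energy A B C D
    pos-q² : + (q ℕ.* q) ≡ q²
    pos-q² = ℤ.pos-* q q
    pos-q⁴ : + (q ℕ.* q ℕ.* (q ℕ.* q)) ≡ q⁴
    pos-q⁴ = trans (ℤ.pos-* (q ℕ.* q) (q ℕ.* q)) (cong₂ _*_ pos-q² pos-q²)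
    pos-αβγδ : + (α ℕ.* γ ℕ.* (β ℕ.* δ)) ≡ + α * + γ * (+ β * + δ)
    pos-αβγδ = trans (ℤ.pos-* (α ℕ.* γ) (β ℕ.* δ)) (cong₂ _*_ (ℤ.pos-* α γ) (ℤ.pos-* β δ))
    drop : ∀ {i j m n} → + m ≡ i → + n ≡ j → i ≤ j → m ℕ.≤ n
    drop refl refl = ℤ.drop‿+≤+
    eq₁ : ∀ q J → q ^ 4 ℕ.* J ≡ q ℕ.* q ℕ.* (q ℕ.* q) ℕ.* J
    eq₁ = solve 2 (λ q J → q :^ 4 :* J := q :* q :* (q :* q) :* J) refl
    eq₂ : ∀ α β γ δ → 2 ℕ.* (α ℕ.* γ ℕ.* (β ℕ.* δ)) ≡ 2 ℕ.* (α ℕ.* β ℕ.* γ ℕ.* δ)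
    eq₂ = solve 4 (λ α β γ δ → con 2 :* (α :* γ :* (β :* δ)) := con 2 :* (α :* β :* γ :* δ)) refl
    eq₃ : ∀ J → J ^ 2 ≡ J ℕ.* J
    eq₃ = solve 1 (λ J → J :^ 2 := J :* J) refl
    eq₄ : ∀ q α β γ δ → 12 ℕ.* (q ℕ.* q ℕ.* (q ℕ.* q ℕ.* (q ℕ.* q)) ℕ.* (α ℕ.* γ ℕ.* (β ℕ.* δ)))
          ≡ 12 ℕ.* (q ^ 6 ℕ.* (α ℕ.* β ℕ.* γ ℕ.* δ))
    eq₄ = solve 5 (λ q α β γ δ → con 12 :* (q :* q :* (q :* q :* (q :* q)) :* (α :* γ :* (β :* δ)))
              := con 12 :* (q :^ 6 :* (α :* β :* γ :* δ))) refl
    to-ℕ : (q⁴ * + J ≤ + 2 * (+ α * + γ * (+ β * + δ)))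
         ⊎ (+ J * + J ≤ + 12 * (q² * q⁴ * (+ α * + γ * (+ β * + δ)))) → _
    to-ℕ (inj₁ le) = inj₁ (subst₂ ℕ._≤_ (sym (eq₁ q J)) (eq₂ α β γ δ) (drop
      (trans (ℤ.pos-* (q ℕ.* q ℕ.* (q ℕ.* q)) J) (cong (_* + J) pos-q⁴))
      (trans (ℤ.pos-* 2 (α ℕ.* γ ℕ.* (β ℕ.* δ))) (cong (+ 2 *_) pos-αβγδ)) le))
    to-ℕ (inj₂ le) = inj₂ (subst₂ ℕ._≤_ (sym (eq₃ J)) (eq₄ q α β γ δ) (drop
      (ℤ.pos-* J J)
      (trans (ℤ.pos-* 12 (q ℕ.* q ℕ.* (q ℕ.* q ℕ.* (q ℕ.* q)) ℕ.* (α ℕ.* γ ℕ.* (β ℕ.* δ))))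
        (cong (+ 12 *_) (trans (ℤ.pos-* (q ℕ.* q ℕ.* (q ℕ.* q ℕ.* (q ℕ.* q))) (α ℕ.* γ ℕ.* (β ℕ.* δ)))
        (cong₂ _*_ (trans (ℤ.pos-* (q ℕ.* q) (q ℕ.* q ℕ.* (q ℕ.* q))) (cong₂ _*_ pos-q² pos-q⁴)) pos-αβγδ)))) le))

  length≤q⁴ : ∀ {xs : List Mat} → Unique xs → length xs ℕ.≤ q ^ 4
  length≤q⁴ {xs} uniq = subst (length xs ℕ.≤_) (eq q) (ℤ.drop‿+≤+ (begin
    ∣ xs ∣                           ≤⟨ length≤ _≟M_ Mats.points uniq ⟩
    ∣ ms ∣                           ≡⟨ Mats.∣points∣ ⟩
    q⁴                               ≡⟨ cong₂ _*_ (ℤ.pos-* q q) (ℤ.pos-* q q) ⟨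
    + (q ℕ.* q) * + (q ℕ.* q)        ≡⟨ ℤ.pos-* (q ℕ.* q) (q ℕ.* q) ⟨
    + (q ℕ.* q ℕ.* (q ℕ.* q))        ∎))
    where
    open ℤ.≤-Reasoning
    eq : ∀ q → q ℕ.* q ℕ.* (q ℕ.* q) ≡ q ^ 4
    eq = solve 1 (λ q → q :* q :* (q :* q) := q :^ 4) refl

  q≢0 : ℕ.NonZero q
  q≢0 = nonZero (Inverse.from enum 0#)
    where
    nonZero : ∀ {n} → Fin n → ℕ.NonZero n
    nonZero {suc n} _ = _

-- Passage to the stated exponents.

open import Data.Nat using (_*_; _≤_)
open +-*-Solver using (solve; _:=_; _:*_; _:^_; con)

-- Squaring the hypothesis produces β²; bounding one factor β by q⁴ cancels one of the two factors
-- q⁴ on the left and leaves the square root of β in the claim. The constant 4 is enlarged to agree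
-- with the other alternative.
main-term-bound : ∀ q .{{_ : ℕ.NonZero q}} J α β γ δ → β ≤ q ^ 4 →
  q ^ 4 * J ≤ 2 * (α * β * γ * δ) →
  J ^ 2 * q ^ 4 ≤ 144 * (α ^ 2 * β * γ ^ 2 * δ ^ 2)
main-term-bound q J α β γ δ β≤q⁴ le = ℕ.*-cancelʳ-≤ _ _ (q ^ 4) {{ℕ.m^n≢0 q 4}} (begin
  J ^ 2 * q ^ 4 * q ^ 4                        ≡⟨ eq₁ J (q ^ 4) ⟩
  (q ^ 4 * J) * (q ^ 4 * J)                    ≤⟨ ℕ.*-mono-≤ le le ⟩
  2 * (α * β * γ * δ) * (2 * (α * β * γ * δ))  ≡⟨ eq₂ α β γ δ ⟩
  4 * (α ^ 2 * β * γ ^ 2 * δ ^ 2) * β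
    ≤⟨ ℕ.*-mono-≤ (ℕ.*-monoˡ-≤ (α ^ 2 * β * γ ^ 2 * δ ^ 2) (ℕ.m≤m+n 4 140)) β≤q⁴ ⟩
  144 * (α ^ 2 * β * γ ^ 2 * δ ^ 2) * q ^ 4 ∎)
  where
  open ℕ.≤-Reasoning
  eq₁ : ∀ J r → J ^ 2 * r * r ≡ (r * J) * (r * J)
  eq₁ = solve 2 (λ J r → J :^ 2 :* r :* r := (r :* J) :* (r :* J)) refl
  eq₂ : ∀ α β γ δ → 2 * (α * β * γ * δ) * (2 * (α * β * γ * δ)) ≡
                    4 * (α ^ 2 * β * γ ^ 2 * δ ^ 2) * β
  eq₂ = solve 4 (λ α β γ δ → con 2 :* (α :* β :* γ :* δ) :* (con 2 :* (α :* β :* γ :* δ))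
              := con 4 :* (α :^ 2 :* β :* γ :^ 2 :* δ :^ 2) :* β) refl

-- Squaring gives q¹², that is q³ in the bound for J, which is then weakened to q¹³, that is to the
-- exponent 13/4.
error-term-bound : ∀ q .{{_ : ℕ.NonZero q}} J p → J ^ 2 ≤ 12 * (q ^ 6 * p) → J ^ 4 ≤ 144 * (q ^ 13 * p ^ 2)
error-term-bound q J p le = begin
  J ^ 4                                        ≡⟨ eq₁ J ⟩
  J ^ 2 * J ^ 2                                ≤⟨ ℕ.*-mono-≤ le le ⟩
  12 * (q ^ 6 * p) * (12 * (q ^ 6 * p))        ≡⟨ eq₂ q p ⟩
  144 * (q ^ 12 * p ^ 2)
    ≤⟨ ℕ.*-monoʳ-≤ 144 (ℕ.*-monoˡ-≤ (p ^ 2) (ℕ.^-monoʳ-≤ q (ℕ.n≤1+n 12))) ⟩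
  144 * (q ^ 13 * p ^ 2) ∎
  where
  open ℕ.≤-Reasoning
  eq₁ : ∀ J → J ^ 4 ≡ J ^ 2 * J ^ 2
  eq₁ = solve 1 (λ J → J :^ 4 := J :^ 2 :* J :^ 2) refl
  eq₂ : ∀ q p → 12 * (q ^ 6 * p) * (12 * (q ^ 6 * p)) ≡ 144 * (q ^ 12 * p ^ 2)
  eq₂ = solve 2 (λ q p → con 12 :* (q :^ 6 :* p) :* (con 12 :* (q :^ 6 :* p)) := con 144 :* (q :^ 12 :* p :^ 2)) refl

theorem2p5 : Σ ℕ λ c → (q : ℕ) → IsPrimePower q → (F : FiniteField q) →
    let open M2 F in
    (A B C D : List Mat) → Unique A → Unique B → Unique C → Unique D →
    let J = energy A B C D in
    (J ^ 2 * q ^ 4 ≤ c * (length A ^ 2 * length B * length C ^ 2 * length D ^ 2))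
    ⊎ (J ^ 4 ≤ c * (q ^ 13 * (length A * length B * length C * length D) ^ 2))
-- 144 = 12² comes from squaring the second alternative. Up to a factor 2, a bound by a sum is a
-- bound by one of its two terms; the second and fourth powers clear the fractional exponents.
theorem2p5 = 144 , λ q _ F A B C D uA uB uC uD →
  let open Counting F
      J = M2.energy F A B C D
      instance _ = q≢0
  in [ (λ le → inj₁ (main-term-bound q J (length A) (length B) (length C) (length D) (length≤q⁴ uB) le))
     , (λ le → inj₂ (error-term-bound q J (length A * length B * length C * length D) le)) ]′
     (energy-dichotomy uA uB uC uD)
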